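{- Let $G$ be a connected finite simple graph on the vertex set $[n]$. Then $\Omega(\mathcal{P}_G,\mathcal{P}_G)$ is normal if and only if $G$ does not contain two odd cycles having no common vertex.
   Context: A finite simple graph is a finite graph with no loops, no multiple edges and no isolated vertices. The edge polytope $\mathcal{P}_G\subset\mathbb{R}^n$ is the convex hull of all $\mathbf{e}_i+\mathbf{e}_j$ with $\{i,j\}$ an edge of $G$. For a lattice polytope $\mathcal{P}\subset\mathbb{R}^n$, $\Omega(\mathcal{P},\mathcal{P})=\mathrm{conv}\{(\mathcal{P}\times\{1\}) \cup (-\mathcal{P}\times\{ -1\})\}\subset \mathbb{R}^{n+1}$. Two lattice polytopes are unimodularly equivalent if there is an affine map between their affine spans that maps the lattice points of one affine span bijectively onto those of the other and maps one polytope onto the other. A lattice polytope $\mathcal{P}$ of dimension $k$ is normal if, for a full-dimensional unimodularly equivalent copy $\mathcal{Q}\subset\mathbb{R}^k$ of $\mathcal{P}$ (such that every lattice point of $\mathbb{Z}^k$ is an affine integer combination of lattice points of $\mathcal{Q}$), for every positive integer $N$ and every $\mathbf{x}\in N\mathcal{Q}\cap\mathbb{Z}^k$ there exist $\mathbf{x}_1,\ldots,\mathbf{x}_N\in\mathcal{Q}\cap\mathbb{Z}^k$ with $\mathbf{x}=\mathbf{x}_1+\cdots+\mathbf{x}_N$, where $N\mathcal{Q}=\{N\mathbf{a}\mid \mathbf{a}\in\mathcal{Q}\}$.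
   Formalization: The polytopes, convex hulls, affine spans and the affine maps giving unimodular equivalence are taken over the rational numbers instead of the real numbers. -}

module Defs where

open import Data.Nat as ℕ using (ℕ; zero; suc)
open import Data.Integer as ℤ using (ℤ; +_)
open import Data.Rational as ℚ using (ℚ; 0ℚ; 1ℚ; _/_)
open import Data.Fin using (Fin; zero; suc; inject₁; fromℕ; _≟_)
open import Data.Bool using (Bool; true; false)
open import Data.Product using (Σ; ∃; ∃-syntax; _×_; _,_)
open import Data.Sum using (_⊎_)
open import Relation.Nullary using (¬_; yes; no)
open import Relation.Binary.PropositionalEquality using (_≡_; _≢_)

record SimpleGraph (n : ℕ) : Set where
  field
    adj        : Fin n → Fin n → Bool
    adj-sym    : ∀ i j → adj i j ≡ adj j i
    adj-irrefl : ∀ i → adj i i ≡ false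
    noIsolated : ∀ i → ∃[ j ] (adj i j ≡ true)
open SimpleGraph public

data Reach {n : ℕ} (G : SimpleGraph n) : Fin n → Fin n → Set where
  here : ∀ {i} → Reach G i i
  step : ∀ {i j k} → adj G i j ≡ true → Reach G j k → Reach G i k

Connected : ∀ {n} → SimpleGraph n → Set
Connected {n} G = ∀ (i j : Fin n) → Reach G i j

record Cycle {n : ℕ} (G : SimpleGraph n) : Set where
  field
    l      : ℕ
    len≥3  : 3 ℕ.≤ suc l
    vert   : Fin (suc l) → Fin n
    inj    : ∀ i j → vert i ≡ vert j → i ≡ j
    consec : ∀ (i : Fin l) → adj G (vert (inject₁ i)) (vert (suc i)) ≡ true
    close  : adj G (vert (fromℕ l)) (vert zero) ≡ true
open Cycle public

OddCycle : ∀ {n} (G : SimpleGraph n) → Cycle G → Set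
OddCycle G C = ∃[ m ] (ℕ.suc (l C) ≡ ℕ.suc (2 ℕ.* m))

TwoDisjointOddCycles : ∀ {n} → SimpleGraph n → Set
TwoDisjointOddCycles G =
  Σ (Cycle G) λ C₁ → Σ (Cycle G) λ C₂ →
    OddCycle G C₁ × OddCycle G C₂ ×
    (∀ i j → vert C₁ i ≢ vert C₂ j)

Vecℚ : ℕ → Set
Vecℚ m = Fin m → ℚ

ι : ℤ → ℚ
ι z = z / 1

_≐_ : ∀ {m} → Vecℚ m → Vecℚ m → Set
x ≐ y = ∀ k → x k ≡ y k

infix 4 _≐_

sumℚ : ∀ {r} → (Fin r → ℚ) → ℚ
sumℚ {zero}  f = 0ℚ
sumℚ {suc r} f = f zero ℚ.+ sumℚ (λ i → f (suc i))

lincomb : ∀ {r m} → (Fin r → ℚ) → (Fin r → Vecℚ m) → Vecℚ m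
lincomb c p k = sumℚ (λ i → c i ℚ.* p i k)

vsum : ∀ {r m} → (Fin r → Vecℚ m) → Vecℚ m
vsum p k = sumℚ (λ i → p i k)

scale : ∀ {m} → ℚ → Vecℚ m → Vecℚ m
scale a x k = a ℚ.* x k

neg : ∀ {m} → Vecℚ m → Vecℚ m
neg x k = ℚ.- x k

SetQ : ℕ → Set₁
SetQ m = Vecℚ m → Set

Conv : ∀ {m} → SetQ m → SetQ m
Conv {m} S x =
  Σ ℕ λ r → Σ (Fin r → Vecℚ m) λ p → Σ (Fin r → ℚ) λ c →
    (∀ i → S (p i)) × (∀ i → 0ℚ ℚ.≤ c i) × (sumℚ c ≡ 1ℚ) × (x ≐ lincomb c p)

Aff : ∀ {m} → SetQ m → SetQ m
Aff {m} S x =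
  Σ ℕ λ r → Σ (Fin r → Vecℚ m) λ p → Σ (Fin r → ℚ) λ c →
    (∀ i → S (p i)) × (sumℚ c ≡ 1ℚ) × (x ≐ lincomb c p)

Lattice : ∀ {m} → SetQ m
Lattice x = ∀ k → ∃[ z ] (x k ≡ ι z)

IntAff : ∀ {m} → SetQ m → SetQ m
IntAff {m} S x =
  Σ ℕ λ r → Σ (Fin r → Vecℚ m) λ p → Σ (Fin r → ℤ) λ c →
    (∀ i → S (p i) × Lattice (p i)) × (sumℚ (λ i → ι (c i)) ≡ 1ℚ) ×
    (x ≐ lincomb (λ i → ι (c i)) p)

-- Normality via a full-dimensional unimodularly equivalent copy

affMap : ∀ {k m} → (Fin k → Fin m → ℚ) → Vecℚ k → Vecℚ m → Vecℚ k
affMap A b y i = sumℚ (λ j → A i j ℚ.* y j) ℚ.+ b i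

Image : ∀ {m k} → (Vecℚ m → Vecℚ k) → SetQ m → SetQ k
Image φ P z = ∃[ y ] (P y × z ≐ φ y)

-- φ restricted to aff(P) maps the lattice points of aff(P) bijectively onto ℤ^k
-- (then Q = φ(P) is full-dimensional in ℚ^k and unimodularly equivalent to P)
LatticeBij : ∀ {m k} → SetQ m → (Vecℚ m → Vecℚ k) → Set
LatticeBij {m} {k} P φ =
  (∀ y → Aff P y → Lattice y → Lattice (φ y)) ×
  (∀ z → Lattice z → ∃[ y ] (Aff P y × Lattice y × φ y ≐ z)) ×
  (∀ y y' → Aff P y → Lattice y → Aff P y' → Lattice y' → φ y ≐ φ y' → y ≐ y')

NormalFD : ∀ {k} → SetQ k → Set
NormalFD {k} Q =
  ∀ (N : ℕ) → 1 ℕ.≤ N → ∀ (x : Vecℚ k) → Lattice x →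
    (∃[ a ] (Q a × x ≐ scale (ι (+ N)) a)) →
    Σ (Fin N → Vecℚ k) λ xs → (∀ i → Q (xs i) × Lattice (xs i)) × (x ≐ vsum xs)

Normal : ∀ {m} → SetQ m → Set
Normal {m} P =
  Σ ℕ λ k → Σ (Fin k → Fin m → ℚ) λ A → Σ (Vecℚ k) λ b →
    LatticeBij P (affMap A b) ×
    (∀ z → Lattice z → IntAff (Image (affMap A b) P) z) ×
    NormalFD (Image (affMap A b) P)

eij : ∀ {n} → Fin n → Fin n → Vecℚ n
eij i j k = δ i k ℚ.+ δ j k
  where
  δ : ∀ {n} → Fin n → Fin n → ℚ
  δ a b with a ≟ b
  ... | yes _ = 1ℚ
  ... | no  _ = 0ℚ

EdgePolytope : ∀ {n} → SimpleGraph n → SetQ n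
EdgePolytope G = Conv (λ x → ∃[ i ] ∃[ j ] (adj G i j ≡ true × x ≐ eij i j))

snoc : ∀ {m} → Vecℚ m → ℚ → Vecℚ (suc m)
snoc {zero}  x t zero    = t
snoc {suc m} x t zero    = x zero
snoc {suc m} x t (suc i) = snoc (λ j → x (suc j)) t i

Ω : ∀ {m} → SetQ m → SetQ (suc m)
Ω P = Conv (λ x → ∃[ p ] (P p × (x ≐ snoc p 1ℚ ⊎ x ≐ snoc (neg p) (ℚ.- 1ℚ))))

{-# OPTIONS --safe #-}

-- Write ê for the vector (e_i + e_j, 1) of an edge {i,j}; the lattice points of Ω are 0 and the vectors ±ê.
--
-- Two disjoint odd cycles of lengths 2p + 1 and 2q + 1 obstruct normality: the difference of the sums of their vertices,
-- with last coordinate p − q, is half a signed sum of 2N edge vectors, N = p + q + 1, hence lies in N·Ω; but covering the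
-- first cycle takes at least p + 1 positive edges, and covering the second at least q + 1 negative ones.
--
-- Conversely, suppose there are no two disjoint odd cycles. A list of signed edges with sum 2u decomposes into closed
-- trails; odd ones occur in even number because the last coordinate of 2u is even, and any two of them share a vertex, so
-- they can be joined into even closed trails. The edges of an even closed trail whose sign follows the pattern + − + − …
-- have the same sum as the remaining ones, so one can keep the smaller half of every trail: u is a signed sum of at most
-- half as many edges. For v in N·Ω, clearing denominators makes D·v a sum of D·N signed edges. With 2ᵏ = q·D + r and k
-- large, 2ᵏ·v = q·(D·v) + r·v is then a sum of fewer than 2ᵏ·(N + 1) signed edges, and k halvings write v with at most N.
module Submission where

open import Defs
open import Data.Bool using (Bool; true; false; not; _xor_)
open import Data.Bool.Properties using (xor-comm) renaming (_≟_ to _≟ᵇ_)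
open import Data.Empty using (⊥; ⊥-elim)
open import Data.Fin using (Fin; zero; suc; inject₁; fromℕ; _≟_)
import Data.Fin.Properties as FinP
open import Data.Fin.Relation.Unary.Top using (view; ‵fromℕ; ‵inject₁)
open import Data.Integer as ℤ using (ℤ; -_; _+_; _*_; 0ℤ; 1ℤ)
import Data.Integer.Properties as ℤP
open import Data.Integer.Tactic.RingSolver using (solve-∀)
open import Data.List using (List; []; _∷_; _++_; length; lookup; tabulate)
open import Data.List.Membership.Propositional using (_∈_; find; lose)
open import Data.List.Membership.Propositional.Properties using (∈-++⁺ˡ; ∈-++⁺ʳ; ∈-++⁻; ∈-lookup)
import Data.List.Properties as ListP
import Data.List.Relation.Unary.All as All
open import Data.List.Relation.Unary.All.Properties using (¬Any⇒All¬)
open import Data.List.Relation.Unary.Any as Any using (here; there)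
open import Data.List.Relation.Unary.Unique.Propositional using (Unique; []; _∷_)
open import Data.Maybe using (Maybe; just; nothing)
open import Data.Nat as ℕ using (ℕ; zero; suc; _≤_; _<_; z≤n; s≤s)
open import Data.Nat.DivMod using (_/_; _%_; m≡m%n+[m/n]*n; m%n<n)
import Data.Nat.Properties as ℕP
import Data.Nat.Tactic.RingSolver as ℕSolver
open import Data.Product using (Σ; ∃-syntax; _×_; _,_; proj₁; proj₂)
open import Data.Rational as ℚ using (ℚ; 0ℚ; 1ℚ; mkℚ)
import Data.Rational.Properties as ℚP
open import Data.Rational.Unnormalised as ℚᵘ using (mkℚᵘ; *≡*)
import Data.Rational.Unnormalised.Properties as ℚᵘP
open import Data.Sum using (_⊎_; inj₁; inj₂; [_,_]′)
open import Function using (_∘_)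
open import Function.Bundles using (_⇔_; mk⇔)
open import Level using (0ℓ)
open import Relation.Binary.PropositionalEquality
  using (_≡_; _≢_; refl; sym; trans; cong; cong₂; subst; module ≡-Reasoning)
open import Relation.Nullary using (¬_; yes; no)
open import Relation.Nullary.Decidable using (_×-dec_; dec⇒maybe)
import Tactic.RingSolver as RingSolver
open import Tactic.RingSolver.Core.AlmostCommutativeRing using (AlmostCommutativeRing; fromCommutativeRing)

open import Algebra.Properties.Semiring.Sum ℤP.+-*-semiring
  using (sum; sum-cong-≗; sum-replicate-zero; sum-init-last; ∑-comm; ∑-distrib-+; *-distribˡ-sum)

-- Halving divides by 2 only, so a general denominator D has to be approached through large powers
-- of 2. The remainder r·v is affordable because its cost, at most D·|B| edges for any fixed list B
-- of signed edges with sum v, does not grow with k. That such a B exists for every lattice point v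
-- is where connectedness enters: alternating walks to a root generate all integer vectors of the
-- span, and suitable coordinates map the lattice of edge vectors bijectively onto ℤᵏ (`Chart`).
-- Normality speaks of an affine copy of Ω. To prove it, the copy may be a coordinate projection. To
-- refute it, the affine map is arbitrary, is known to be bijective on lattice points only and may
-- move the origin, so decompositions have to be pulled back through it. Rational points are handled
-- by `Rep` in both directions: a convex combination becomes one denominator and a list of signed
-- edges, with repetitions in the role of coefficients.

Even : ℤ → Set
Even x = ∃[ z ] (x ≡ z + z)

one-not-even : ¬ Even 1ℤ
one-not-even (z , e) = ℕP.even≢odd ℤ.∣ z ∣ 0 (sym (trans (cong ℤ.∣_∣ (trans e (double z))) (ℤP.abs-* (ℤ.+ 2) z)))
  where
  double : ∀ z → z + z ≡ ℤ.+ 2 * z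
  double = solve-∀

even-cancelʳ : ∀ {x y} → Even (x + y) → Even y → Even x
even-cancelʳ {x} {y} (z , e) (w , f) = z + - w , trans (trans (a x y) (cong₂ (λ s t → s + - t) e f)) (b z w)
  where
  a : ∀ x y → x ≡ (x + y) + - y
  a = solve-∀
  b : ∀ z w → z + z + - (w + w) ≡ (z + - w) + (z + - w)
  b = solve-∀

even-+ : ∀ {x y} → Even x → Even y → Even (x + y)
even-+ (z , refl) (w , refl) = z + w , a z w
  where
  a : ∀ z w → z + z + (w + w) ≡ (z + w) + (z + w)
  a = solve-∀

-- Integer unit vectors and elementary counting.

unit : ∀ {n} → Fin n → Fin n → ℤ
unit zero    zero    = 1ℤ
unit zero    (suc _) = 0ℤ
unit (suc _) zero    = 0ℤ
unit (suc i) (suc j) = unit i j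

unit-diag : ∀ {n} (i : Fin n) → unit i i ≡ 1ℤ
unit-diag zero    = refl
unit-diag (suc i) = unit-diag i

unit-≢ : ∀ {n} {i j : Fin n} → i ≢ j → unit i j ≡ 0ℤ
unit-≢ {i = zero}  {zero}  i≢j = ⊥-elim (i≢j refl)
unit-≢ {i = zero}  {suc _} _   = refl
unit-≢ {i = suc _} {zero}  _   = refl
unit-≢ {i = suc _} {suc _} i≢j = unit-≢ (i≢j ∘ cong suc)

unit-inject₁ : ∀ {n} (i j : Fin n) → unit (inject₁ i) (inject₁ j) ≡ unit i j
unit-inject₁ zero    zero    = refl
unit-inject₁ zero    (suc _) = refl
unit-inject₁ (suc _) zero    = refl
unit-inject₁ (suc i) (suc j) = unit-inject₁ i j

unit-inject₁-last : ∀ {n} (i : Fin n) → unit (inject₁ i) (fromℕ n) ≡ 0ℤ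
unit-inject₁-last zero    = refl
unit-inject₁-last (suc i) = unit-inject₁-last i

unit-last-inject₁ : ∀ {n} (i : Fin n) → unit (fromℕ n) (inject₁ i) ≡ 0ℤ
unit-last-inject₁ zero    = refl
unit-last-inject₁ (suc i) = unit-last-inject₁ i

lookup-injective : ∀ {A : Set} {xs : List A} → Unique xs → ∀ i j → lookup xs i ≡ lookup xs j → i ≡ j
lookup-injective (_ ∷ _)  zero    zero    _ = refl
lookup-injective (x ∷ _)  zero    (suc j) e = ⊥-elim (All.lookup x (∈-lookup j) e)
lookup-injective (x ∷ _)  (suc i) zero    e = ⊥-elim (All.lookup x (∈-lookup i) (sym e))
lookup-injective (_ ∷ xs) (suc i) (suc j) e = cong suc (lookup-injective xs i j e)

n<2^n : ∀ n → n < 2 ℕ.^ n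
n<2^n zero    = s≤s z≤n
n<2^n (suc n) = ℕP.≤-trans (s≤s (n<2^n n)) (subst (suc (2 ℕ.^ n) ≤_) (cong (2 ℕ.^ n ℕ.+_) (sym (ℕP.+-identityʳ _)))
  (ℕP.+-monoˡ-≤ (2 ℕ.^ n) (ℕP.≤-trans (s≤s z≤n) (n<2^n n))))

sum-unit : ∀ {n} (g : Fin n → ℤ) i → sum (λ j → g j * unit j i) ≡ g i
sum-unit g zero    = trans (cong₂ _+_ (ℤP.*-identityʳ (g zero)) (zeros (λ j → g (suc j)))) (ℤP.+-identityʳ (g zero))
  where
  zeros : ∀ {n} (h : Fin n → ℤ) → sum (λ j → h j * 0ℤ) ≡ 0ℤ
  zeros {n} h = trans (sum-cong-≗ (λ j → ℤP.*-zeroʳ (h j))) (sum-replicate-zero n)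
sum-unit g (suc i) = trans (cong₂ _+_ (ℤP.*-zeroʳ (g zero)) (sum-unit (λ j → g (suc j)) i)) (ℤP.+-identityˡ (g (suc i)))

unit-comm : ∀ {n} (i j : Fin n) → unit i j ≡ unit j i
unit-comm zero    zero    = refl
unit-comm zero    (suc j) = refl
unit-comm (suc i) zero    = refl
unit-comm (suc i) (suc j) = unit-comm i j

-- The integers inside the rationals, and clearing denominators.

ringℚ : AlmostCommutativeRing 0ℓ 0ℓ
ringℚ = fromCommutativeRing ℚP.+-*-commutativeRing (λ x → dec⇒maybe (0ℚ ℚP.≟ x))

toℚᵘ-ι : ∀ z → ℚ.toℚᵘ (ι z) ℚᵘ.≃ mkℚᵘ z 0
toℚᵘ-ι z = ℚP.toℚᵘ-fromℚᵘ (mkℚᵘ z 0)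

ι-+ : ∀ a b → ι (a + b) ≡ ι a ℚ.+ ι b
ι-+ a b = ℚP.toℚᵘ-injective (begin
  ℚ.toℚᵘ (ι (a + b))                    ≈⟨ toℚᵘ-ι (a + b) ⟩
  mkℚᵘ (a + b) 0                        ≈⟨ *≡* (ar a b) ⟩
  mkℚᵘ a 0 ℚᵘ.+ mkℚᵘ b 0                ≈⟨ ℚᵘP.+-cong (ℚᵘP.≃-sym (toℚᵘ-ι a)) (ℚᵘP.≃-sym (toℚᵘ-ι b)) ⟩
  ℚ.toℚᵘ (ι a) ℚᵘ.+ ℚ.toℚᵘ (ι b)        ≈⟨ ℚᵘP.≃-sym (ℚP.toℚᵘ-homo-+ (ι a) (ι b)) ⟩
  ℚ.toℚᵘ (ι a ℚ.+ ι b)                  ∎)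
  where
  open ℚᵘP.≃-Reasoning
  ar : ∀ a b → (a + b) * 1ℤ ≡ (a * 1ℤ + b * 1ℤ) * 1ℤ
  ar = solve-∀

ι-* : ∀ a b → ι (a * b) ≡ ι a ℚ.* ι b
ι-* a b = ℚP.toℚᵘ-injective (begin
  ℚ.toℚᵘ (ι (a * b))                    ≈⟨ toℚᵘ-ι (a * b) ⟩
  mkℚᵘ a 0 ℚᵘ.* mkℚᵘ b 0                ≈⟨ ℚᵘP.*-cong (ℚᵘP.≃-sym (toℚᵘ-ι a)) (ℚᵘP.≃-sym (toℚᵘ-ι b)) ⟩
  ℚ.toℚᵘ (ι a) ℚᵘ.* ℚ.toℚᵘ (ι b)        ≈⟨ ℚᵘP.≃-sym (ℚP.toℚᵘ-homo-* (ι a) (ι b)) ⟩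
  ℚ.toℚᵘ (ι a ℚ.* ι b)                  ∎)
  where open ℚᵘP.≃-Reasoning

ι-neg : ∀ a → ι (- a) ≡ ℚ.- ι a
ι-neg a = begin
  ι (- a)                     ≡⟨ ar (ι (- a)) (ι a) ⟩
  (ι (- a) ℚ.+ ι a) ℚ.+ ℚ.- ι a ≡⟨ cong (ℚ._+ ℚ.- ι a) (trans (sym (ι-+ (- a) a)) (cong ι (ℤP.+-inverseˡ a))) ⟩
  0ℚ ℚ.+ ℚ.- ι a              ≡⟨ ℚP.+-identityˡ _ ⟩
  ℚ.- ι a                     ∎
  where
  open ≡-Reasoning
  ar : ∀ x y → x ≡ (x ℚ.+ y) ℚ.+ ℚ.- y
  ar = RingSolver.solve-∀ ringℚ

ι-injective : ∀ {a b} → ι a ≡ ι b → a ≡ b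
ι-injective {a} {b} e with ℚᵘP.≃-trans (ℚᵘP.≃-sym (toℚᵘ-ι a)) (ℚᵘP.≃-trans (ℚᵘP.≃-reflexive (cong ℚ.toℚᵘ e)) (toℚᵘ-ι b))
... | *≡* f = trans (sym (ℤP.*-identityʳ a)) (trans f (ℤP.*-identityʳ b))

ι-denominator : ∀ c → ι (ℚ.↧ c) ℚ.* c ≡ ι (ℚ.↥ c)
ι-denominator c@(mkℚ p q _) = ℚP.toℚᵘ-injective (begin
  ℚ.toℚᵘ (ι (ℚ.↧ c) ℚ.* c)              ≈⟨ ℚP.toℚᵘ-homo-* (ι (ℚ.↧ c)) c ⟩
  ℚ.toℚᵘ (ι (ℚ.↧ c)) ℚᵘ.* ℚ.toℚᵘ c      ≈⟨ ℚᵘP.*-cong (toℚᵘ-ι (ℚ.↧ c)) ℚᵘP.≃-refl ⟩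
  mkℚᵘ (ℤ.+ suc q) 0 ℚᵘ.* mkℚᵘ p q      ≈⟨ *≡* (trans (ar (ℤ.+ suc q) p)
      (cong (λ d → p * ℤ.+ suc d) (sym (ℕP.+-identityʳ q)))) ⟩
  mkℚᵘ p 0                              ≈⟨ ℚᵘP.≃-sym (toℚᵘ-ι p) ⟩
  ℚ.toℚᵘ (ι p)                          ∎)
  where
  open ℚᵘP.≃-Reasoning
  ar : ∀ q p → q * p * 1ℤ ≡ p * q
  ar = solve-∀

recip : ℕ → ℚ
recip D = 1ℤ ℚ./ suc D

recip-inverse : ∀ D → recip D ℚ.* ι (ℤ.+ suc D) ≡ 1ℚ
recip-inverse D = ℚP.toℚᵘ-injective (begin
  ℚ.toℚᵘ (recip D ℚ.* ι (ℤ.+ suc D))             ≈⟨ ℚP.toℚᵘ-homo-* (recip D) (ι (ℤ.+ suc D)) ⟩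
  ℚ.toℚᵘ (recip D) ℚᵘ.* ℚ.toℚᵘ (ι (ℤ.+ suc D))   ≈⟨ ℚᵘP.*-cong (ℚP.toℚᵘ-fromℚᵘ (mkℚᵘ 1ℤ D)) (toℚᵘ-ι (ℤ.+ suc D)) ⟩
  mkℚᵘ 1ℤ D ℚᵘ.* mkℚᵘ (ℤ.+ suc D) 0              ≈⟨ *≡* (cong ℤ.+_ (cong suc (ar D))) ⟩
  mkℚᵘ 1ℤ 0                                      ∎)
  where
  open ℚᵘP.≃-Reasoning
  ar : ∀ D → ((D ℕ.+ 0) ℕ.* 1) ≡ ((D ℕ.* 1) ℕ.+ 0)
  ar D = trans (ℕP.*-identityʳ _) (cong (ℕ._+ 0) (sym (ℕP.*-identityʳ D)))

recip≥0 : ∀ D → 0ℚ ℚ.≤ recip D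
recip≥0 D = ℚP.nonNegative⁻¹ (recip D) {{ℚP.normalize-nonNeg 1 (suc D)}}

ι-cancelˡ : ∀ D {x y} → ι (ℤ.+ suc D) ℚ.* x ≡ ι (ℤ.+ suc D) ℚ.* y → x ≡ y
ι-cancelˡ D {x} {y} e = trans (expand x) (trans (cong (recip D ℚ.*_) e) (sym (expand y)))
  where
  expand : ∀ x → x ≡ recip D ℚ.* (ι (ℤ.+ suc D) ℚ.* x)
  expand x = trans (sym (ℚP.*-identityˡ x)) (trans (cong (ℚ._* x) (sym (recip-inverse D)))
      (ℚP.*-assoc (recip D) (ι (ℤ.+ suc D)) x))

-- Finite rational sums and coordinates of vectors.

sumℚ-cong : ∀ {r} {f g : Fin r → ℚ} → (∀ i → f i ≡ g i) → sumℚ f ≡ sumℚ g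
sumℚ-cong {zero}  e = refl
sumℚ-cong {suc r} e = cong₂ ℚ._+_ (e zero) (sumℚ-cong (λ i → e (suc i)))

sumℚ-*ˡ : ∀ {r} a (f : Fin r → ℚ) → sumℚ (λ i → a ℚ.* f i) ≡ a ℚ.* sumℚ f
sumℚ-*ˡ {zero}  a f = sym (ℚP.*-zeroʳ a)
sumℚ-*ˡ {suc r} a f = trans (cong (a ℚ.* f zero ℚ.+_) (sumℚ-*ˡ a (λ i → f (suc i))))
    (sym (ℚP.*-distribˡ-+ a (f zero) (sumℚ (λ i → f (suc i)))))

sumℚ-+ : ∀ {r} (f g : Fin r → ℚ) → sumℚ (λ i → f i ℚ.+ g i) ≡ sumℚ f ℚ.+ sumℚ g
sumℚ-+ {zero}  f g = refl
sumℚ-+ {suc r} f g = trans (cong (f zero ℚ.+ g zero ℚ.+_) (sumℚ-+ (λ i → f (suc i)) (λ i → g (suc i))))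
  (ar (f zero) (g zero) (sumℚ (λ i → f (suc i))) (sumℚ (λ i → g (suc i))))
  where
  ar : ∀ a b c d → a ℚ.+ b ℚ.+ (c ℚ.+ d) ≡ a ℚ.+ c ℚ.+ (b ℚ.+ d)
  ar = RingSolver.solve-∀ ringℚ

sumℚ-zero : ∀ r → sumℚ {r} (λ _ → 0ℚ) ≡ 0ℚ
sumℚ-zero zero    = refl
sumℚ-zero (suc r) = trans (ℚP.+-identityˡ _) (sumℚ-zero r)

sumℚ-swap : ∀ {r s} (f : Fin r → Fin s → ℚ) → sumℚ (λ i → sumℚ (λ j → f i j)) ≡ sumℚ (λ j → sumℚ (λ i → f i j))
sumℚ-swap {zero}  {s} f = sym (sumℚ-zero s)
sumℚ-swap {suc r} {s} f = trans (cong (sumℚ (f zero) ℚ.+_) (sumℚ-swap (λ i → f (suc i))))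
    (sym (sumℚ-+ (f zero) (λ j → sumℚ (λ i → f (suc i) j))))

sumℚ-const : ∀ r c → sumℚ {r} (λ _ → c) ≡ ι (ℤ.+ r) ℚ.* c
sumℚ-const zero    c = sym (ℚP.*-zeroˡ c)
sumℚ-const (suc r) c = trans (cong (c ℚ.+_) (sumℚ-const r c))
    (trans (ar c (ι (ℤ.+ r))) (cong (ℚ._* c) (sym (ι-+ 1ℤ (ℤ.+ r)))))
  where
  ar : ∀ c x → c ℚ.+ x ℚ.* c ≡ (1ℚ ℚ.+ x) ℚ.* c
  ar = RingSolver.solve-∀ ringℚ

sumℚ-ι : ∀ {r} (f : Fin r → ℤ) → sumℚ (λ i → ι (f i)) ≡ ι (sum f)
sumℚ-ι {zero}  f = refl
sumℚ-ι {suc r} f = trans (cong (ι (f zero) ℚ.+_) (sumℚ-ι (λ i → f (suc i))))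
    (sym (ι-+ (f zero) (sum (λ i → f (suc i)))))

sumℚ-unit : ∀ {r} (i : Fin r) (y : Fin r → ℚ) → sumℚ (λ j → ι (unit i j) ℚ.* y j) ≡ y i
sumℚ-unit {suc r} zero y = trans (cong₂ ℚ._+_ (ℚP.*-identityˡ (y zero))
  (trans (sumℚ-cong (λ j → ℚP.*-zeroˡ (y (suc j)))) (sumℚ-zero r))) (ℚP.+-identityʳ (y zero))
sumℚ-unit (suc i) y = trans (cong₂ ℚ._+_ (ℚP.*-zeroˡ (y zero)) (sumℚ-unit i (λ j → y (suc j))))
    (ℚP.+-identityˡ (y (suc i)))

snoc-inject₁ : ∀ {m} (x : Vecℚ m) t i → snoc x t (inject₁ i) ≡ x i
snoc-inject₁ x t zero    = refl
snoc-inject₁ x t (suc i) = snoc-inject₁ (λ j → x (suc j)) t i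

snoc-last : ∀ {m} (x : Vecℚ m) t → snoc x t (fromℕ m) ≡ t
snoc-last {zero}  x t = refl
snoc-last {suc m} x t = snoc-last (λ j → x (suc j)) t

≐-snoc : ∀ {m} {y : Vecℚ (suc m)} {x t} → (∀ i → y (inject₁ i) ≡ x i) → y (fromℕ m) ≡ t → y ≐ snoc x t
≐-snoc {x = x} {t} e f k with view k
... | ‵fromℕ     = trans f (sym (snoc-last x t))
... | ‵inject₁ i = trans (e i) (sym (snoc-inject₁ x t i))

Conv-point : ∀ {m} (S : SetQ m) {x} → S x → Conv S x
Conv-point S {x} s = 1 , (λ _ → x) , (λ _ → 1ℚ) , (λ _ → s) , (λ _ → ℚ.*≤* (ℤ.+≤+ z≤n)) , refl ,
  λ k → sym (trans (ℚP.+-identityʳ _) (ℚP.*-identityˡ (x k)))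

eij≡ : ∀ {n} (i j k : Fin n) → eij i j k ≡ ι (unit i k + unit j k)
eij≡ i j k with i ≟ k | j ≟ k
... | yes refl | yes refl rewrite unit-diag i = refl
... | yes refl | no j≢k   rewrite unit-diag i | unit-≢ j≢k = refl
... | no i≢k   | yes refl rewrite unit-diag j | unit-≢ i≢k = refl
... | no i≢k   | no j≢k   rewrite unit-≢ i≢k | unit-≢ j≢k = refl

-- Missing entries will stand for the origin, which also lies in Ω, so that a sum of fewer than N
-- edges still has N summands. Entries beyond N are dropped, whence the length bound in `sum-pad`.
pad : ∀ {A : Set} → List A → ∀ N → Fin N → Maybe A
pad []      N       i       = nothing
pad (x ∷ L) (suc N) zero    = just x
pad (x ∷ L) (suc N) (suc i) = pad L N i

-- Estimates for integer sums.

≤-or-> : ∀ x y → x ℤ.≤ y ⊎ y ℤ.< x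
≤-or-> x y with x ℤ.≤? y
... | yes x≤y = inj₁ x≤y
... | no  x≰y = inj₂ (ℤP.≰⇒> x≰y)

sum-mono : ∀ {r} {f g : Fin r → ℤ} → (∀ i → f i ℤ.≤ g i) → sum f ℤ.≤ sum g
sum-mono {zero}  le = ℤP.≤-refl
sum-mono {suc r} le = ℤP.+-mono-≤ (le zero) (sum-mono (λ i → le (suc i)))

sum-const : ∀ r x → sum {r} (λ _ → x) ≡ ℤ.+ r * x
sum-const zero    x = refl
sum-const (suc r) x = trans (cong (x +_) (sum-const r x)) (sym (ℤP.suc-* (ℤ.+ r) x))

sum-negate : ∀ {r} (f : Fin r → ℤ) → sum (λ i → - f i) ≡ - sum f
sum-negate {zero}  f = refl
sum-negate {suc r} f = trans (cong (- f zero +_) (sum-negate (λ i → f (suc i))))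
    (sym (ℤP.neg-distrib-+ (f zero) (sum (λ i → f (suc i)))))

unit≥0 : ∀ {n} (i j : Fin n) → 0ℤ ℤ.≤ unit i j
unit≥0 zero    zero    = ℤ.+≤+ z≤n
unit≥0 zero    (suc _) = ℤ.+≤+ z≤n
unit≥0 (suc _) zero    = ℤ.+≤+ z≤n
unit≥0 (suc i) (suc j) = unit≥0 i j

sum-unit-injective≤1 : ∀ {r n} (x : Fin n) (f : Fin r → Fin n) → (∀ i j → f i ≡ f j → i ≡ j) →
  sum (λ j → unit x (f j)) ℤ.≤ 1ℤ
sum-unit-injective≤1 {zero}  x f inj = ℤ.+≤+ z≤n
sum-unit-injective≤1 {suc r} x f inj with x ≟ f zero
... | yes x≡ = ℤP.≤-reflexive (trans (cong₂ _+_ (trans (cong (unit x) (sym x≡)) (unit-diag x)) zeros) refl)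
  where
  zeros : sum (λ j → unit x (f (suc j))) ≡ 0ℤ
  zeros = trans (sum-cong-≗ (λ j → unit-≢ (λ e → FinP.0≢1+n (inj zero (suc j) (trans (sym x≡) e)))))
      (sum-replicate-zero r)
... | no x≢ = ℤP.≤-trans (ℤP.≤-reflexive (trans (cong (_+ sum (λ j → unit x (f (suc j)))) (unit-≢ x≢))
    (ℤP.+-identityˡ _)))
  (sum-unit-injective≤1 x (λ j → f (suc j)) (λ i j e → FinP.suc-injective (inj (suc i) (suc j) e)))

-- The linear part of an affine map.

module _ {k m : ℕ} (A : Fin k → Fin m → ℚ) (b : Vecℚ k) where

  linear : Vecℚ m → Vecℚ k
  linear y i = sumℚ (λ j → A i j ℚ.* y j)

  linear-cong : ∀ {y z} → y ≐ z → linear y ≐ linear z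
  linear-cong e i = sumℚ-cong (λ j → cong (A i j ℚ.*_) (e j))

  linear-scale : ∀ c y → linear (λ j → c ℚ.* y j) ≐ (λ i → c ℚ.* linear y i)
  linear-scale c y i = trans (sumℚ-cong (λ j → ar (A i j) c (y j))) (sumℚ-*ˡ c (λ j → A i j ℚ.* y j))
    where
    ar : ∀ a c y → a ℚ.* (c ℚ.* y) ≡ c ℚ.* (a ℚ.* y)
    ar = RingSolver.solve-∀ ringℚ

  linear-+ : ∀ y z → linear (λ j → y j ℚ.+ z j) ≐ (λ i → linear y i ℚ.+ linear z i)
  linear-+ y z i = trans (sumℚ-cong (λ j → ℚP.*-distribˡ-+ (A i j) (y j) (z j)))
      (sumℚ-+ (λ j → A i j ℚ.* y j) (λ j → A i j ℚ.* z j))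

  linear-vsum : ∀ {r} (y : Fin r → Vecℚ m) → linear (vsum y) ≐ vsum (λ s → linear (y s))
  linear-vsum y i = trans (sumℚ-cong (λ j → sym (sumℚ-*ˡ (A i j) (λ s → y s j)))) (sumℚ-swap (λ j s → A i j ℚ.* y s j))

  linear-zero : linear (λ _ → 0ℚ) ≐ (λ _ → 0ℚ)
  linear-zero i = trans (sumℚ-cong (λ j → ℚP.*-zeroʳ (A i j))) (sumℚ-zero m)

+-cancelʳ : ∀ x y z → x ℚ.+ z ≡ y ℚ.+ z → x ≡ y
+-cancelʳ x y z e = trans (ar x z) (trans (cong (ℚ._+ ℚ.- z) e) (sym (ar y z)))
  where
  ar : ∀ x z → x ≡ x ℚ.+ z ℚ.+ ℚ.- z
  ar = RingSolver.solve-∀ ringℚ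

-- Signed edges and their sums.

module _ {n : ℕ} (G : SimpleGraph n) where

  edgeVec : Fin n → Fin n → Fin (suc n) → ℤ
  edgeVec i j k = unit (inject₁ i) k + unit (inject₁ j) k + unit (fromℕ n) k

  edgeVec-top : ∀ i j → edgeVec i j (fromℕ n) ≡ 1ℤ
  edgeVec-top i j = cong₂ _+_ (cong₂ _+_ (unit-inject₁-last i) (unit-inject₁-last j)) (unit-diag (fromℕ n))

  edgeVec-inner : ∀ i j v → edgeVec i j (inject₁ v) ≡ unit i v + unit j v
  edgeVec-inner i j v = trans (cong₂ _+_ (cong₂ _+_ (unit-inject₁ i v) (unit-inject₁ j v)) (unit-last-inject₁ v))
      (ℤP.+-identityʳ (unit i v + unit j v))

  record SEdge : Set where
    constructor sedge
    field
      positive : Bool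
      src tgt  : Fin n
      isEdge   : adj G src tgt ≡ true

  vec : SEdge → Fin (suc n) → ℤ
  vec (sedge true  i j _) k = edgeVec i j k
  vec (sedge false i j _) k = - edgeVec i j k

  sumE : List SEdge → Fin (suc n) → ℤ
  sumE []      k = 0ℤ
  sumE (e ∷ L) k = vec e k + sumE L k

  sumE-++ : ∀ L M k → sumE (L ++ M) k ≡ sumE L k + sumE M k
  sumE-++ []      M k = sym (ℤP.+-identityˡ _)
  sumE-++ (e ∷ L) M k = trans (cong (vec e k +_) (sumE-++ L M k)) (sym (ℤP.+-assoc (vec e k) _ _))

  adj-flip : ∀ {i j} → adj G i j ≡ true → adj G j i ≡ true
  adj-flip {i} {j} p = trans (adj-sym G j i) p

  vec-flip : ∀ s {i j} (p : adj G i j ≡ true) (q : adj G j i ≡ true) k → vec (sedge s i j p) k ≡ vec (sedge s j i q) k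
  vec-flip true  {i} {j} p q k = cong (_+ unit (fromℕ n) k) (ℤP.+-comm (unit (inject₁ i) k) (unit (inject₁ j) k))
  vec-flip false {i} {j} p q k = cong (λ x → - (x + unit (fromℕ n) k))
      (ℤP.+-comm (unit (inject₁ i) k) (unit (inject₁ j) k))

  -- Signed trails

  data Trail : Fin n → Fin n → Set where
    []   : ∀ {a} → Trail a a
    step : ∀ {a b c} → Bool → adj G a b ≡ true → Trail b c → Trail a c

  edges : ∀ {a b} → Trail a b → List SEdge
  edges []           = []
  edges (step s p T) = sedge s _ _ p ∷ edges T

  -- The end vertex is left out, so that a closed trail does not list its base point a second time
  -- for returning there, and there are as many entries as steps.
  verts : ∀ {a b} → Trail a b → List (Fin n)
  verts []               = []
  verts (step {a} s p T) = a ∷ verts T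

  odd : ∀ {a b} → Trail a b → Bool
  odd []           = false
  odd (step s p T) = not (odd T)

  infixr 5 _⊕_
  _⊕_ : ∀ {a b c} → Trail a b → Trail b c → Trail a c
  []         ⊕ U = U
  step s p T ⊕ U = step s p (T ⊕ U)

  edges-⊕ : ∀ {a b c} (T : Trail a b) (U : Trail b c) → edges (T ⊕ U) ≡ edges T ++ edges U
  edges-⊕ []           U = refl
  edges-⊕ (step s p T) U = cong (_ ∷_) (edges-⊕ T U)

  verts-⊕ : ∀ {a b c} (T : Trail a b) (U : Trail b c) → verts (T ⊕ U) ≡ verts T ++ verts U
  verts-⊕ []           U = refl
  verts-⊕ (step s p T) U = cong (_ ∷_) (verts-⊕ T U)

  odd-⊕ : ∀ {a b c} (T : Trail a b) (U : Trail b c) → odd (T ⊕ U) ≡ odd T xor odd U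
  odd-⊕ []           U = refl
  odd-⊕ (step s p T) U = trans (cong not (odd-⊕ T U)) (not-xor (odd T))
    where
    not-xor : ∀ x {y} → not (x xor y) ≡ not x xor y
    not-xor true  {true}  = refl
    not-xor true  {false} = refl
    not-xor false = refl

  -- The edges of a trail whose sign agrees, resp. disagrees, with the alternating signs +, -, +, ...
  plus minus : ∀ {a b} → Trail a b → List SEdge
  plus  []               = []
  plus  (step true  p T) = sedge true _ _ p ∷ minus T
  plus  (step false p T) = minus T
  minus []               = []
  minus (step true  p T) = plus T
  minus (step false p T) = sedge false _ _ p ∷ plus T

  plus+minus : ∀ {a b} (T : Trail a b) k → sumE (plus T) k + sumE (minus T) k ≡ sumE (edges T) k
  plus+minus []               k = refl
  plus+minus (step {a} {b} true  p T) k =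
    trans (ar (edgeVec a b k) (sumE (minus T) k) (sumE (plus T) k)) (cong (edgeVec a b k +_) (plus+minus T k))
    where
    ar : ∀ e m p → e + m + p ≡ e + (p + m)
    ar = solve-∀
  plus+minus (step {a} {b} false p T) k =
    trans (ar (- edgeVec a b k) (sumE (minus T) k) (sumE (plus T) k)) (cong (- edgeVec a b k +_) (plus+minus T k))
    where
    ar : ∀ e m p → m + (e + p) ≡ e + (p + m)
    ar = solve-∀

  length-plus+minus : ∀ {a b} (T : Trail a b) → length (plus T) ℕ.+ length (minus T) ≡ length (edges T)
  length-plus+minus []               = refl
  length-plus+minus (step true  p T) = cong suc (trans (ℕP.+-comm (length (minus T)) _) (length-plus+minus T))
  length-plus+minus (step false p T) =
    trans (ℕP.+-suc (length (minus T)) _) (cong suc (trans (ℕP.+-comm (length (minus T)) _) (length-plus+minus T)))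

  endSign : Bool → ℤ
  endSign true  = 1ℤ
  endSign false = - 1ℤ

  parity : Bool → ℤ
  parity true  = 1ℤ
  parity false = 0ℤ

  -- The value of the alternating sum ê₁ - ê₂ + ê₃ - ... along a trail from `a` to `b`: inner
  -- vertices cancel, and e_a ± e_b remains with last coordinate 1 for an odd and 0 for an even
  -- number of steps.
  boundary : Bool → Fin n → Fin n → Fin (suc n) → ℤ
  boundary o a b k = unit (inject₁ a) k + endSign o * unit (inject₁ b) k + parity o * unit (fromℕ n) k

  private
    step-boundary : ∀ o a b c k → boundary (not o) a c k ≡ edgeVec a b k + - boundary o b c k
    step-boundary true  a b c k = ar (unit (inject₁ a) k) (unit (inject₁ b) k) (unit (inject₁ c) k) (unit (fromℕ n) k)
      where
      ar : ∀ x y z l → x + - 1ℤ * z + 0ℤ * l ≡ x + y + l + - (y + 1ℤ * z + 1ℤ * l)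
      ar = solve-∀
    step-boundary false a b c k = ar (unit (inject₁ a) k) (unit (inject₁ b) k) (unit (inject₁ c) k) (unit (fromℕ n) k)
      where
      ar : ∀ x y z l → x + 1ℤ * z + 1ℤ * l ≡ x + y + l + - (y + - 1ℤ * z + 0ℤ * l)
      ar = solve-∀

  -- The difference does not depend on the actual signs. Where the pattern asks for +, a positive
  -- edge adds ê to `plus`, while a negative edge adds -ê to `minus`, which is subtracted; where it
  -- asks for -, both contribute -ê. The alternating sum along the trail is left.
  plus-minus : ∀ {a b} (T : Trail a b) k → sumE (plus T) k ≡ sumE (minus T) k + boundary (odd T) a b k
  plus-minus {a} [] k = ar (unit (inject₁ a) k) (unit (fromℕ n) k)
    where
    ar : ∀ x l → 0ℤ ≡ 0ℤ + (x + - 1ℤ * x + 0ℤ * l)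
    ar = solve-∀
  plus-minus (step {a} {b} {c} true p T) k =
    trans (ar (edgeVec a b k) (sumE (minus T) k) (boundary (odd T) b c k) (plus-minus T k))
      (cong (sumE (plus T) k +_) (sym (step-boundary (odd T) a b c k)))
    where
    swap : ∀ e m x → e + m ≡ m + x + (e + - x)
    swap = solve-∀
    ar : ∀ {q} e m x → q ≡ m + x → e + m ≡ q + (e + - x)
    ar e m x refl = swap e m x
  plus-minus (step {a} {b} {c} false p T) k =
    trans (ar (edgeVec a b k) (sumE (minus T) k) (boundary (odd T) b c k) (plus-minus T k))
      (cong (- edgeVec a b k + sumE (plus T) k +_) (sym (step-boundary (odd T) a b c k)))
    where
    swap : ∀ e m x → m ≡ - e + (m + x) + (e + - x)
    swap = solve-∀
    ar : ∀ {q} e m x → q ≡ m + x → m ≡ - e + q + (e + - x)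
    ar e m x refl = swap e m x

  -- Modulo 2 only the boundary remains of a trail; the parity arguments below rest on this.
  sum-trail : ∀ {a b} (T : Trail a b) k → sumE (edges T) k ≡ (sumE (minus T) k + sumE (minus T) k) + boundary
      (odd T) a b k
  sum-trail {a} {b} T k = trans (sym (plus+minus T k))
    (trans (cong (_+ sumE (minus T) k) (plus-minus T k)) (ar (sumE (minus T) k) (boundary (odd T) a b k)))
    where
    ar : ∀ m b → m + b + m ≡ m + m + b
    ar = solve-∀

  even-closed-boundary : ∀ {a} (T : Trail a a) → odd T ≡ false → ∀ k → boundary (odd T) a a k ≡ 0ℤ
  even-closed-boundary {a} T o k rewrite o = ar (unit (inject₁ a) k) (unit (fromℕ n) k)
    where
    ar : ∀ x l → x + - 1ℤ * x + 0ℤ * l ≡ 0ℤ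
    ar = solve-∀

  trail-even⇒boundary-even : ∀ {a b} (T : Trail a b) k → Even (sumE (edges T) k) → Even (boundary (odd T) a b k)
  trail-even⇒boundary-even {a} {b} T k ev = even-cancelʳ
    (subst Even (trans (sum-trail T k) (ℤP.+-comm (sumE (minus T) k + sumE (minus T) k) (boundary (odd T) a b k))) ev)
    (sumE (minus T) k , refl)

  closed-even-sum : ∀ {a} (T : Trail a a) → odd T ≡ false → ∀ k → sumE (edges T) k ≡ sumE (minus T) k + sumE (minus T) k
  closed-even-sum T o k = trans (sum-trail T k)
    (trans (cong (sumE (minus T) k + sumE (minus T) k +_) (even-closed-boundary T o k)) (ℤP.+-identityʳ _))

  -- A closed odd trail has boundary 2e_a with last coordinate 1. It is even at every vertex and odd
  -- in the last coordinate, which therefore counts odd trails modulo 2.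
  closed-odd-not-even : ∀ {a} (T : Trail a a) → odd T ≡ true → ¬ Even (sumE (edges T) (fromℕ n))
  closed-odd-not-even {a} T o ev = one-not-even (subst Even bd (trail-even⇒boundary-even T (fromℕ n) ev))
    where
    bd : boundary (odd T) a a (fromℕ n) ≡ 1ℤ
    bd rewrite o | unit-inject₁-last a | unit-diag (fromℕ n) = refl

  closed-vertex-even : ∀ {a} (T : Trail a a) i → Even (sumE (edges T) (inject₁ i))
  closed-vertex-even {a} T i = subst Even (sym (sum-trail T (inject₁ i)))
      (even-+ (sumE (minus T) (inject₁ i) , refl) (bd (odd T)))
    where
    ar : ∀ x → x + 1ℤ * x + 1ℤ * 0ℤ ≡ x + x
    ar = solve-∀
    u = unit (inject₁ a) (inject₁ i)
    ar′ : ∀ x l → x + - 1ℤ * x + 0ℤ * l ≡ 0ℤ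
    ar′ = solve-∀
    bd : ∀ o → Even (boundary o a a (inject₁ i))
    bd true  rewrite unit-last-inject₁ i = u , ar u
    bd false = 0ℤ , ar′ u (unit (fromℕ n) (inject₁ i))

  open-not-even : ∀ {a b} (T : Trail b a) → a ≢ b → ¬ Even (sumE (edges T) (inject₁ b))
  open-not-even {a} {b} T a≢b ev = one-not-even (subst Even bd (trail-even⇒boundary-even T (inject₁ b) ev))
    where
    bd : boundary (odd T) b a (inject₁ b) ≡ 1ℤ
    bd rewrite unit-inject₁ b b | unit-diag b | unit-inject₁ a b | unit-≢ a≢b | unit-last-inject₁ b = ar
        (endSign (odd T)) (parity (odd T))
      where
      ar : ∀ x y → 1ℤ + x * 0ℤ + y * 0ℤ ≡ 1ℤ
      ar = solve-∀

  Halvable : List SEdge → Set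
  Halvable L = ∃[ L′ ] (2 ℕ.* length L′ ≤ length L × (∀ k → sumE L′ k + sumE L′ k ≡ sumE L k))

  halvable-++ : ∀ {L M} → Halvable L → Halvable M → Halvable (L ++ M)
  halvable-++ {L} {M} (L′ , l , e) (M′ , m , f) = L′ ++ M′ , len , sm
    where
    len : 2 ℕ.* length (L′ ++ M′) ≤ length (L ++ M)
    len rewrite ListP.length-++ L′ {M′} | ListP.length-++ L {M} | ℕP.*-distribˡ-+ 2 (length L′)
        (length M′) = ℕP.+-mono-≤ l m
    ar : ∀ x y → x + y + (x + y) ≡ x + x + (y + y)
    ar = solve-∀
    sm : ∀ k → sumE (L′ ++ M′) k + sumE (L′ ++ M′) k ≡ sumE (L ++ M) k
    sm k rewrite sumE-++ L′ M′ k | sumE-++ L M k = trans (ar (sumE L′ k) (sumE M′ k)) (cong₂ _+_ (e k) (f k))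

  halvable-resp : ∀ {L M} → length L ≡ length M → (∀ k → sumE L k ≡ sumE M k) → Halvable L → Halvable M
  halvable-resp l e (L′ , m , f) = L′ , subst (_ ≤_) l m , λ k → trans (f k) (e k)

  -- Either half of an even closed trail sums to half of the total; take the shorter one.
  halvable-closed-even : ∀ {a} (T : Trail a a) → odd T ≡ false → Halvable (edges T)
  halvable-closed-even {a} T o with ℕP.≤-total (length (plus T)) (length (minus T))
  ... | inj₁ p≤m = plus T , shorter , λ k → trans (cong (sumE (plus T) k +_) (eq k)) (plus+minus T k)
    where
    eq : ∀ k → sumE (plus T) k ≡ sumE (minus T) k
    eq k = trans (plus-minus T k) (trans (cong (sumE (minus T) k +_) (even-closed-boundary T o k)) (ℤP.+-identityʳ _))
    shorter : 2 ℕ.* length (plus T) ≤ length (edges T)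
    shorter rewrite sym (length-plus+minus T) | ℕP.+-identityʳ (length (plus T)) = ℕP.+-monoʳ-≤ _ p≤m
  ... | inj₂ m≤p = minus T , shorter , λ k → sym (closed-even-sum T o k)
    where
    shorter : 2 ℕ.* length (minus T) ≤ length (edges T)
    shorter rewrite sym (length-plus+minus T) | ℕP.+-identityʳ (length (minus T)) = ℕP.+-monoˡ-≤ _ m≤p

  -- The edge is turned so that it ends in `b` and can be put in front of a trail starting there.
  -- Only length and sum of the remaining list are recorded: halving depends on nothing else, so no
  -- permutations of lists have to be tracked.
  record Incident (b : Fin n) (L : List SEdge) : Set where
    field
      sgn     : Bool
      {other} : Fin n
      edge    : adj G other b ≡ true
      rest    : List SEdge
      len     : length L ≡ suc (length rest)
      total   : ∀ k → sumE L k ≡ vec (sedge sgn other b edge) k + sumE rest k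

  incident? : ∀ b L → Incident b L ⊎ sumE L (inject₁ b) ≡ 0ℤ
  incident? b [] = inj₂ refl
  incident? b (e@(sedge s i j p) ∷ L) with j ≟ b | i ≟ b
  ... | yes refl | _ = inj₁ record { sgn = s ; edge = p ; rest = L ; len = refl ; total = λ k → refl }
  ... | no _ | yes refl = inj₁ record
    { sgn = s ; edge = adj-flip p ; rest = L ; len = refl ; total = λ k → cong (_+ sumE L k)
        (vec-flip s p (adj-flip p) k) }
  ... | no j≢b | no i≢b with incident? b L
  ...   | inj₁ I = inj₁ record
    { sgn = sgn ; edge = edge ; rest = e ∷ rest ; len = cong suc len
    ; total = λ k → trans (cong (vec e k +_) (total k)) (ar (vec e k) (vec (sedge sgn other b edge) k) (sumE rest k)) }
    where
    open Incident I
    ar : ∀ x y z → x + (y + z) ≡ y + (x + z)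
    ar = solve-∀
  ...   | inj₂ z = inj₂ (trans (cong₂ _+_ (vec0 s) z) refl)
    where
    e0 : edgeVec i j (inject₁ b) ≡ 0ℤ
    e0 = trans (edgeVec-inner i j b) (cong₂ _+_ (unit-≢ i≢b) (unit-≢ j≢b))
    vec0 : ∀ s → vec (sedge s i j p) (inject₁ b) ≡ 0ℤ
    vec0 true  = e0
    vec0 false = cong -_ e0

  record Closing {b a} (T : Trail b a) (L : List SEdge) : Set where
    field
      closed : Trail a a
      rest   : List SEdge
      len    : length (edges closed) ℕ.+ length rest ≡ length (edges T) ℕ.+ length L
      rest≤  : length rest ≤ length L
      total  : ∀ k → sumE (edges closed) k + sumE rest k ≡ sumE (edges T) k + sumE L k

  -- The trail grows at its start `b`. As long as `b` differs from `a`, the coordinate of `T` at `b`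
  -- is odd while the total is even; so `L` has an odd, in particular nonzero, coordinate at `b` and
  -- contains an edge there. The number `m` bounds the recursion.
  closing : ∀ m {a b} (T : Trail b a) L → length L ≤ m → (∀ i → Even
      (sumE (edges T) (inject₁ i) + sumE L (inject₁ i))) → Closing T L
  closing m {a} {b} T L l ev with a ≟ b
  ... | yes refl = record { closed = T ; rest = L ; len = refl ; rest≤ = ℕP.≤-refl ; total = λ k → refl }
  ... | no a≢b with incident? b L
  ...   | inj₂ z = ⊥-elim (open-not-even T a≢b (subst Even (trans (cong (sumE (edges T) (inject₁ b) +_) z)
      (ℤP.+-identityʳ _)) (ev b)))
  ...   | inj₁ I with m | subst (_≤ m) (Incident.len I) l
  ...     | suc m′ | s≤s l′ = record
    { closed = R.closed ; rest = R.rest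
    ; len = trans R.len (trans (sym (ℕP.+-suc (length (edges T)) _)) (cong (length (edges T) ℕ.+_) (sym I.len)))
    ; rest≤ = ℕP.≤-trans R.rest≤ (ℕP.≤-trans (ℕP.n≤1+n _) (ℕP.≤-reflexive (sym I.len)))
    ; total = λ k → trans (R.total k) (move k) }
    where
    module I = Incident I
    ar : ∀ x y z → x + y + z ≡ y + (x + z)
    ar = solve-∀
    move : ∀ k → sumE (edges (step I.sgn I.edge T)) k + sumE I.rest k ≡ sumE (edges T) k + sumE L k
    move k = trans (ar (vec (sedge I.sgn I.other b I.edge) k) (sumE (edges T) k) (sumE I.rest k))
        (cong (sumE (edges T) k +_) (sym (I.total k)))
    module R = Closing (closing m′ (step I.sgn I.edge T) I.rest l′ (λ i → subst Even (sym (move (inject₁ i))) (ev i)))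
  length-verts-⊕ : ∀ {a b c} (T : Trail a b) (U : Trail b c) →
    length (verts (T ⊕ U)) ≡ length (verts T) ℕ.+ length (verts U)
  length-verts-⊕ T U = trans (cong length (verts-⊕ T U)) (ListP.length-++ (verts T))

  -- Odd cycles in closed trails of odd length

  record SplitAt {a b : Fin n} (x : Fin n) (T : Trail a b) : Set where
    field
      before   : Trail a x
      after    : Trail x b
      splits   : T ≡ before ⊕ after
      nonempty : 0 < length (verts after)

  splitAt : ∀ {a b x} (T : Trail a b) → x ∈ verts T → SplitAt x T
  splitAt (step s p T) (here refl) = record { before = [] ; after = step s p T ; splits = refl ; nonempty = s≤s z≤n }
  splitAt (step s p T) (there x∈T) = record
    { before = step s p before ; after = after ; splits = cong (step s p) splits ; nonempty = nonempty }
    where open SplitAt (splitAt T x∈T)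

  -- Both strict inequalities serve the induction: `after>0` makes the loop shorter than the trail,
  -- `loop>0` makes what is left after cutting out the loop shorter. The part after the loop is
  -- nonempty because `verts` omits the end vertex.
  record Repeat {a b : Fin n} (T : Trail a b) : Set where
    field
      {at}    : Fin n
      before  : Trail a at
      loop    : Trail at at
      after   : Trail at b
      splits  : T ≡ before ⊕ loop ⊕ after
      loop>0  : 0 < length (verts loop)
      after>0 : 0 < length (verts after)

  unique-or-repeat : ∀ {a b} (T : Trail a b) → Unique (verts T) ⊎ Repeat T
  unique-or-repeat [] = inj₁ []
  unique-or-repeat (step {a} s p T) with unique-or-repeat T
  ... | inj₂ R = inj₂ record
    { before = step s p before ; loop = loop ; after = after ; splits = cong
        (step s p) splits ; loop>0 = loop>0 ; after>0 = after>0 }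
    where open Repeat R
  ... | inj₁ u with Any.any? (a ≟_) (verts T)
  ...   | yes a∈T = inj₂ record
    { before = [] ; loop = step s p before ; after = after ; splits = cong
        (step s p) splits ; loop>0 = s≤s z≤n ; after>0 = nonempty }
    where open SplitAt (splitAt T a∈T)
  ...   | no a∉T = inj₁ (¬Any⇒All¬ (verts T) a∉T ∷ u)

  consecutive : ∀ {a b c} s (p : adj G a b ≡ true) (T : Trail b c) (i : Fin (length (verts T))) →
    adj G (lookup (a ∷ verts T) (inject₁ i)) (lookup (verts T) i) ≡ true
  consecutive s p (step t q T) zero    = p
  consecutive s p (step t q T) (suc i) = consecutive t q T i

  last-adjacent : ∀ {a b c} s (p : adj G a b ≡ true) (T : Trail b c) →
    adj G (lookup (a ∷ verts T) (fromℕ (length (verts T)))) c ≡ true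
  last-adjacent s p []           = p
  last-adjacent s p (step t q T) = last-adjacent t q T

  trail-length : ∀ {a b} (T : Trail a b) →
    (odd T ≡ false → ∃[ m ] (length (verts T) ≡ 2 ℕ.* m)) × (odd T ≡ true → ∃[ m ] (length (verts T) ≡ suc (2 ℕ.* m)))
  trail-length [] = (λ _ → 0 , refl) , λ ()
  trail-length (step s p T) with odd T | trail-length T
  ... | true  | _ , o = (λ _ → let m , e = o refl in suc m , trans (cong suc e) (sym (ℕP.*-suc 2 m))) , λ ()
  ... | false | e , _ = (λ ()) , λ _ → let m , f = e refl in m , cong suc f

  OddCycleWithin : ∀ {a b} → Trail a b → Set
  OddCycleWithin T = Σ (Cycle G) λ C → OddCycle G C × (∀ i → vert C i ∈ verts T)

  simple-odd-cycle : ∀ {a} (T : Trail a a) → odd T ≡ true → Unique (verts T) → OddCycleWithin T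
  -- A single step would be a loop of the graph, and two steps are an even number, so the trail has
  -- the three vertices that a cycle needs.
  simple-odd-cycle {a} (step s p []) _ _ with () ← trans (sym p) (adj-irrefl G a)
  simple-odd-cycle T@(step s p T′@(step t q (step _ _ _))) o u = C , proj₂ (trail-length T) o , λ i → ∈-lookup i
    where
    C : Cycle G
    C = record
      { l      = length (verts T′)
      ; len≥3  = s≤s (s≤s (s≤s z≤n))
      ; vert   = lookup (verts T)
      ; inj    = lookup-injective u
      ; consec = consecutive s p T′
      ; close  = last-adjacent s p T′
      }

  -- A repeated vertex splits off a closed loop. The parities of the loop and of the rest add up to
  -- odd, so one of the two is odd and shorter; without repetition the trail is itself a cycle.
  odd-closed⇒odd-cycle : ∀ m {a} (T : Trail a a) → length (verts T) ≤ m → odd T ≡ true → OddCycleWithin T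
  odd-closed⇒odd-cycle zero    []           _ ()
  odd-closed⇒odd-cycle (suc m) T l o with unique-or-repeat T
  ... | inj₁ u = simple-odd-cycle T o u
  ... | inj₂ R = go (odd loop) refl
    where
    open Repeat R
    rest : Trail _ _
    rest = before ⊕ after
    within : length (verts before) ℕ.+ (length (verts loop) ℕ.+ length (verts after)) ≤ suc m
    within = subst (_≤ suc m) (trans (cong (length ∘ verts) splits)
        (trans (length-verts-⊕ before (loop ⊕ after)) (cong (length (verts before) ℕ.+_)
        (length-verts-⊕ loop after)))) l
    shorter : ∀ {x y} → x ≤ y → 0 < y → suc x ≤ x ℕ.+ y
    shorter {x} {y} _ y>0 = subst (_≤ x ℕ.+ y) (ℕP.+-comm x 1) (ℕP.+-monoʳ-≤ x y>0)
    loop≤ : length (verts loop) ≤ m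
    loop≤ = ℕP.≤-pred (ℕP.≤-trans (subst (_≤ length (verts loop) ℕ.+ length (verts after)) (ℕP.+-comm _ 1)
        (ℕP.+-monoʳ-≤ _ after>0))
      (ℕP.≤-trans (ℕP.m≤n+m _ (length (verts before))) within))
    rest≤ : length (verts rest) ≤ m
    rest≤ rewrite length-verts-⊕ before after = ℕP.≤-pred (ℕP.≤-trans
      (subst (_≤ length (verts before) ℕ.+ (length (verts loop) ℕ.+ length (verts after)))
          (ℕP.+-suc (length (verts before)) _)
        (ℕP.+-monoʳ-≤ (length (verts before)) (ℕP.+-monoˡ-≤ _ loop>0))) within)
    odds : odd T ≡ odd before xor (odd loop xor odd after)
    odds = trans (cong odd splits) (trans (odd-⊕ before (loop ⊕ after)) (cong (odd before xor_) (odd-⊕ loop after)))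
    vertsT : verts T ≡ verts before ++ verts loop ++ verts after
    vertsT = trans (cong verts splits) (trans (verts-⊕ before (loop ⊕ after))
        (cong (verts before ++_) (verts-⊕ loop after)))
    go : ∀ b → odd loop ≡ b → OddCycleWithin T
    go true e with odd-closed⇒odd-cycle m loop loop≤ e
    ... | C , oc , C⊆ = C , oc , λ i → subst (_ ∈_) (sym vertsT) (∈-++⁺ʳ (verts before) (∈-++⁺ˡ (C⊆ i)))
    go false e with odd-closed⇒odd-cycle m rest rest≤ (trans (odd-⊕ before after)
        (trans (sym (trans odds (cong (λ b → odd before xor (b xor odd after)) e))) o))
    ... | C , oc , C⊆ = C , oc , λ i → subst (_ ∈_) (sym vertsT)
      ([ ∈-++⁺ˡ , (λ x → ∈-++⁺ʳ (verts before) (∈-++⁺ʳ (verts loop) x)) ]′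
        (∈-++⁻ (verts before) (subst (_ ∈_) (verts-⊕ before after) (C⊆ i))))

  module _ (¬two : ¬ TwoDisjointOddCycles G) where

    -- Halving signed edge sums

    -- Trails without common vertex would contain disjoint odd cycles, as the extracted cycles stay
    -- within the vertices of their trails.
    odd-trails-meet : ∀ {a b} (T : Trail a a) (U : Trail b b) → odd T ≡ true → odd U ≡ true →
      ∃[ x ] (x ∈ verts T × x ∈ verts U)
    odd-trails-meet T U oT oU with Any.any? (λ x → Any.any? (x ≟_) (verts U)) (verts T)
    ... | yes meet = let x , x∈T , x∈U = find meet in x , x∈T , x∈U
    ... | no disjoint with odd-closed⇒odd-cycle _ T ℕP.≤-refl oT | odd-closed⇒odd-cycle _ U ℕP.≤-refl oU
    ...   | C , oC , C⊆ | D , oD , D⊆ =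
      ⊥-elim (¬two (C , D , oC , oD , λ i j e → disjoint (lose (C⊆ i) (subst (_∈ verts U) (sym e) (D⊆ j)))))

    record Rotation {a : Fin n} (x : Fin n) (T : Trail a a) : Set where
      field
        rotated : Trail x x
        same    : ∀ k → sumE (edges rotated) k ≡ sumE (edges T) k
        len     : length (edges rotated) ≡ length (edges T)
        parity≡ : odd rotated ≡ odd T

    rotate : ∀ {a x} (T : Trail a a) → x ∈ verts T → Rotation x T
    rotate T x∈T with splitAt T x∈T
    ... | record { before = B ; after = A ; splits = refl } = record
      { rotated = A ⊕ B
      ; same    = same
      ; len     = len
      ; parity≡ = trans (odd-⊕ A B) (trans (xor-comm (odd A) (odd B)) (sym (odd-⊕ B A)))
      }
      where
      same : ∀ k → sumE (edges (A ⊕ B)) k ≡ sumE (edges (B ⊕ A)) k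
      same k rewrite edges-⊕ A B | edges-⊕ B A | sumE-++ (edges A) (edges B) k | sumE-++ (edges B) (edges A) k =
        ℤP.+-comm (sumE (edges A) k) (sumE (edges B) k)
      len : length (edges (A ⊕ B)) ≡ length (edges (B ⊕ A))
      len rewrite edges-⊕ A B | edges-⊕ B A | ListP.length-++ (edges A) {edges B} | ListP.length-++
          (edges B) {edges A} =
        ℕP.+-comm (length (edges A)) (length (edges B))

    record Merge {a b : Fin n} (T : Trail a a) (U : Trail b b) : Set where
      field
        {at}   : Fin n
        merged : Trail at at
        isEven : odd merged ≡ false
        len    : length (edges merged) ≡ length (edges T) ℕ.+ length (edges U)
        total  : ∀ k → sumE (edges merged) k ≡ sumE (edges T) k + sumE (edges U) k

    -- Both closed trails are restarted at a common vertex and traversed one after the other. The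
    -- changed starting points and order affect neither the sum nor the number of edges.
    merge : ∀ {a b} (T : Trail a a) (U : Trail b b) → odd T ≡ true → odd U ≡ true → Merge T U
    merge T U oT oU with odd-trails-meet T U oT oU
    ... | x , x∈T , x∈U = record
      { merged = RT.rotated ⊕ RU.rotated
      ; isEven = trans (odd-⊕ RT.rotated RU.rotated) (cong₂ _xor_ (trans RT.parity≡ oT) (trans RU.parity≡ oU))
      ; len = trans (cong length (edges-⊕ RT.rotated RU.rotated))
          (trans (ListP.length-++ (edges RT.rotated)) (cong₂ ℕ._+_ RT.len RU.len))
      ; total = λ k → trans (cong (λ L → sumE L k) (edges-⊕ RT.rotated RU.rotated))
          (trans (sumE-++ (edges RT.rotated) _ k) (cong₂ _+_ (RT.same k) (RU.same k)))
      }
      where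
      module RT = Rotation (rotate T x∈T)
      module RU = Rotation (rotate U x∈U)

    OddClosed : Set
    OddClosed = Σ (Fin n) λ a → Σ (Trail a a) λ T → odd T ≡ true

    pendingEdges : Maybe OddClosed → List SEdge
    pendingEdges nothing            = []
    pendingEdges (just (_ , T , _)) = edges T

    length-regroup : ∀ (A B C D : List SEdge) → length A ≡ length B ℕ.+ length C →
      length (A ++ D) ≡ length B ℕ.+ (length C ℕ.+ length D)
    length-regroup A B C D e = trans (ListP.length-++ A) (trans (cong (ℕ._+ length D) e)
        (ℕP.+-assoc (length B) (length C) (length D)))

    sum-regroup : ∀ (A B C D : List SEdge) → (∀ k → sumE A k ≡ sumE B k + sumE C k) →
      ∀ k → sumE (A ++ D) k ≡ sumE B k + (sumE C k + sumE D k)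
    sum-regroup A B C D e k =
      trans (sumE-++ A D k) (trans (cong (_+ sumE D k) (e k)) (ℤP.+-assoc (sumE B k) (sumE C k) (sumE D k)))

    -- P is an odd closed trail, already removed from the list, that awaits a partner.
    halvable-even : ∀ m (P : Maybe OddClosed) L → length L ≤ m →
      (∀ i → Even (sumE L (inject₁ i))) → Even (sumE (pendingEdges P) (fromℕ n) + sumE L (fromℕ n)) →
      Halvable (pendingEdges P ++ L)
    halvable-even m nothing [] _ _ _ = [] , z≤n , λ k → refl
    -- An odd trail cannot stay without partner: the last coordinate would be odd.
    halvable-even m (just (a , T , o)) [] _ _ ev = ⊥-elim (closed-odd-not-even T o (subst Even (ℤP.+-identityʳ _) ev))
    halvable-even (suc m) P (sedge s i j p ∷ L) (s≤s l) evV evL = go P (odd closed) refl evL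
      where
      T₀ : Trail i j
      T₀ = step s p []
      LL = sedge s i j p ∷ L
      ar₀ : ∀ e r → e + 0ℤ + r ≡ e + r
      ar₀ = solve-∀
      move : ∀ k → sumE (edges T₀) k + sumE L k ≡ sumE LL k
      move k = ar₀ (vec (sedge s i j p) k) (sumE L k)
      open Closing (closing (length L) T₀ L ℕP.≤-refl (λ v → subst Even (sym (move (inject₁ v))) (evV v)))
      sum≡ : ∀ k → sumE LL k ≡ sumE (edges closed) k + sumE rest k
      sum≡ k = sym (trans (total k) (move k))
      l′ : length rest ≤ m
      l′ = ℕP.≤-trans rest≤ l
      evV′ : ∀ v → Even (sumE rest (inject₁ v))
      evV′ v = even-cancelʳ (subst Even (trans (sum≡ (inject₁ v)) (ℤP.+-comm (sumE (edges closed) (inject₁ v)) _))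
          (evV v)) (closed-vertex-even closed v)
      pc = edges closed
      resp : ∀ M X → length M ≡ length X ℕ.+ (length pc ℕ.+ length rest) →
        (∀ k → sumE M k ≡ sumE X k + (sumE pc k + sumE rest k)) → Halvable M → Halvable (X ++ LL)
      resp M X lM sM = halvable-resp {M} {X ++ LL} (trans lM (trans (cong (length X ℕ.+_) len)
          (sym (ListP.length-++ X {LL}))))
        (λ k → trans (sM k) (trans (cong (sumE X k +_) (sym (sum≡ k))) (sym (sumE-++ X LL k))))
      ar₁ : ∀ x y z → x + (y + z) ≡ y + (x + z)
      ar₁ = solve-∀
      ar₁ℕ : ∀ x y z → x ℕ.+ (y ℕ.+ z) ≡ y ℕ.+ (x ℕ.+ z)
      ar₁ℕ x y z = trans (sym (ℕP.+-assoc x y z)) (trans (cong (ℕ._+ z) (ℕP.+-comm x y)) (ℕP.+-assoc y x z))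
      last = fromℕ n
      -- The first edge has been completed to a closed trail. If even, it is halved at once and the
      -- pending trail is kept. If odd, it becomes pending when none is, and is otherwise merged
      -- with the pending one into an even trail, which is halved.
      go : ∀ P o → odd closed ≡ o → Even (sumE (pendingEdges P) last + sumE LL last) → Halvable (pendingEdges P ++ LL)
      go P false o ev = resp (pc ++ X ++ rest) X lenM sumM
        (halvable-++ {pc} {X ++ rest} (halvable-closed-even closed o)
          (halvable-even m P rest l′ evV′ (even-cancelʳ (subst Even
              (ar₂ (sumE X last) (sumE pc last) (sumE rest last) (sum≡ last)) ev)
              (sumE (minus closed) last , closed-even-sum closed o last))))
        where
        X = pendingEdges P
        ar₂ : ∀ x c r {s} → s ≡ c + r → x + s ≡ x + r + c
        ar₂ x c r refl = id₂ x c r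
          where
          id₂ : ∀ x c r → x + (c + r) ≡ x + r + c
          id₂ = solve-∀
        lenM = trans (ListP.length-++ pc) (trans (cong (length pc ℕ.+_) (ListP.length-++ X))
            (ar₁ℕ (length pc) (length X) (length rest)))
        sumM : ∀ k → sumE (pc ++ X ++ rest) k ≡ sumE X k + (sumE pc k + sumE rest k)
        sumM k = trans (sumE-++ pc (X ++ rest) k) (trans (cong (sumE pc k +_) (sumE-++ X rest k))
          (ar₁ (sumE pc k) (sumE X k) (sumE rest k)))
      go nothing true o ev = resp (pc ++ rest) [] (ListP.length-++ pc {rest})
          (λ k → trans (sumE-++ pc rest k) (sym (ℤP.+-identityˡ (sumE pc k + sumE rest k))))
        (halvable-even m (just (_ , closed , o)) rest l′ evV′ (subst Even (trans (ℤP.+-identityˡ _) (sum≡ last)) ev))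
      go (just (_ , T , oT)) true o ev = resp (edges merged ++ rest) (edges T) lenM sumM
        (halvable-++ {edges merged} {rest} (halvable-closed-even merged isEven)
          (halvable-even m nothing rest l′ evV′ (even-cancelʳ
              (subst Even (ar₂ (sumE (edges T) last) (sumE pc last) (sumE rest last) (sum≡ last) (M.total last)) ev)
            (sumE (minus merged) last , closed-even-sum merged isEven last))))
        where
        module M = Merge (merge T closed oT o)
        open M using (merged; isEven)
        ar₂ : ∀ x c r {s m} → s ≡ c + r → m ≡ x + c → x + s ≡ 0ℤ + r + m
        ar₂ x c r refl refl = id₂ x c r
          where
          id₂ : ∀ x c r → x + (c + r) ≡ 0ℤ + r + (x + c)
          id₂ = solve-∀
        lenM = length-regroup (edges merged) (edges T) pc rest M.len
        sumM = sum-regroup (edges merged) (edges T) pc rest M.total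

    halve : ∀ L (u : Fin (suc n) → ℤ) → (∀ k → sumE L k ≡ u k + u k) →
        ∃[ L′ ] (2 ℕ.* length L′ ≤ length L × (∀ k → sumE L′ k ≡ u k))
    halve L u e = let L′ , l , f = halved in L′ , l , λ k → double-injective (sumE L′ k) (u k) (trans (f k) (e k))
      where
      halved : Halvable L
      halved = halvable-even (length L) nothing L ℕP.≤-refl (λ i → u (inject₁ i) , e (inject₁ i))
        (u (fromℕ n) , trans (ℤP.+-identityˡ (sumE L (fromℕ n))) (e (fromℕ n)))
      dbl : ∀ x → x + x ≡ ℤ.+ 2 * x
      dbl = solve-∀
      double-injective : ∀ x y → x + x ≡ y + y → x ≡ y
      double-injective x y e = ℤP.*-cancelˡ-≡ (ℤ.+ 2) x y (trans (sym (dbl x)) (trans e (dbl y)))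

  -- Multiples of edge lists, and division by an arbitrary denominator.

  negE : List SEdge → List SEdge
  negE []                  = []
  negE (sedge s i j p ∷ L) = sedge (not s) i j p ∷ negE L

  sum-negE : ∀ L k → sumE (negE L) k ≡ - sumE L k
  sum-negE [] k = refl
  sum-negE (sedge true i j p ∷ L) k = trans (cong (- edgeVec i j k +_) (sum-negE L k))
      (sym (ℤP.neg-distrib-+ (edgeVec i j k) (sumE L k)))
  sum-negE (sedge false i j p ∷ L) k = trans (cong₂ _+_ (sym (ℤP.neg-involutive (edgeVec i j k))) (sum-negE L k))
      (sym (ℤP.neg-distrib-+ (- edgeVec i j k) (sumE L k)))

  length-negE : ∀ L → length (negE L) ≡ length L
  length-negE []      = refl
  length-negE (e ∷ L) = cong suc (length-negE L)

  copies : ℕ → List SEdge → List SEdge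
  copies zero    L = []
  copies (suc q) L = L ++ copies q L

  length-copies : ∀ q L → length (copies q L) ≡ q ℕ.* length L
  length-copies zero    L = refl
  length-copies (suc q) L = trans (ListP.length-++ L) (cong (length L ℕ.+_) (length-copies q L))

  sum-copies : ∀ q L k → sumE (copies q L) k ≡ ℤ.+ q * sumE L k
  sum-copies zero    L k = refl
  sum-copies (suc q) L k = trans (sumE-++ L (copies q L) k) (trans (cong (sumE L k +_) (sum-copies q L k))
      (sym (ℤP.suc-* (ℤ.+ q) (sumE L k))))

  multiple : ℤ → List SEdge → List SEdge
  multiple (ℤ.+ q)      L = copies q L
  multiple (ℤ.-[1+ q ]) L = negE (copies (suc q) L)

  sum-multiple : ∀ z L k → sumE (multiple z L) k ≡ z * sumE L k
  sum-multiple (ℤ.+ q)      L k = sum-copies q L k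
  sum-multiple (ℤ.-[1+ q ]) L k = trans (sum-negE (copies (suc q) L) k)
      (trans (cong -_ (sum-copies (suc q) L k)) (ℤP.neg-distribˡ-* (ℤ.+ suc q) (sumE L k)))

  length-multiple : ∀ z L → length (multiple z L) ≡ ℤ.∣ z ∣ ℕ.* length L
  length-multiple (ℤ.+ q)      L = length-copies q L
  length-multiple (ℤ.-[1+ q ]) L = trans (length-negE (copies (suc q) L)) (length-copies (suc q) L)

  concatFin : ∀ {r} → (Fin r → List SEdge) → List SEdge
  concatFin {zero}  f = []
  concatFin {suc r} f = f zero ++ concatFin (λ i → f (suc i))

  sum-concatFin : ∀ {r} (f : Fin r → List SEdge) k → sumE (concatFin f) k ≡ sum (λ i → sumE (f i) k)
  sum-concatFin {zero}  f k = refl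
  sum-concatFin {suc r} f k = trans (sumE-++ (f zero) _ k) (cong (sumE (f zero) k +_)
      (sum-concatFin (λ i → f (suc i)) k))

  module _ (¬two : ¬ TwoDisjointOddCycles G) where

    halve-iter : ∀ k L (u : Fin (suc n) → ℤ) → (∀ c → sumE L c ≡ ℤ.+ (2 ℕ.^ k) * u c) →
      ∃[ L′ ] (2 ℕ.^ k ℕ.* length L′ ≤ length L × (∀ c → sumE L′ c ≡ u c))
    halve-iter zero L u e = L , ℕP.≤-reflexive (ℕP.*-identityˡ _) , λ c → trans (e c) (ℤP.*-identityˡ (u c))
    halve-iter (suc k) L u e with halve-iter k L (λ c → u c + u c) (λ c → trans (e c) (double (2 ℕ.^ k) (u c)))
      where
      double : ∀ p x → ℤ.+ (2 ℕ.* p) * x ≡ ℤ.+ p * (x + x)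
      double p x rewrite ℕP.+-identityʳ p | ℤP.pos-+ p p = ar (ℤ.+ p) x
        where
        ar : ∀ p x → (p + p) * x ≡ p * (x + x)
        ar = solve-∀
    ... | L′ , l , f with halve ¬two L′ u f
    ...   | L″ , l′ , g = L″ , ℕP.≤-trans (ℕP.≤-reflexive (regroup (2 ℕ.^ k) (length L″)))
        (ℕP.≤-trans (ℕP.*-monoʳ-≤ (2 ℕ.^ k) l′) l) , g
      where
      regroup : ∀ p x → 2 ℕ.* p ℕ.* x ≡ p ℕ.* (2 ℕ.* x)
      regroup p x = trans (cong (ℕ._* x) (ℕP.*-comm 2 p)) (ℕP.*-assoc p 2 x)

    -- Write 2^k = q·D + r with 2^k > D·|B|: then 2^k·v is a sum of at most 2^k·N + r·|B| < 2^k·(N + 1) signed edges,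
    -- and k halvings leave at most N of them.
    divide : ∀ D N (v : Fin (suc n) → ℤ) L B → length L ≤ suc D ℕ.* N →
      (∀ c → sumE L c ≡ ℤ.+ suc D * v c) → (∀ c → sumE B c ≡ v c) →
      ∃[ L′ ] (length L′ ≤ N × (∀ c → sumE L′ c ≡ v c))
    divide D N v L B len eL eB = let L′ , l , e = halve-iter k L* v eL* in
      L′ , ℕP.≤-pred (ℕP.*-cancelˡ-< P (length L′) (suc N) (ℕP.≤-<-trans l len*)) , e
      where
      -- This bound on the cost of the remainder serves as the exponent too, since k < 2ᵏ.
      k = suc D ℕ.* length B
      P = 2 ℕ.^ k
      q = P / suc D
      r = P % suc D
      L* = copies q L ++ copies r B
      P≡ : P ≡ r ℕ.+ q ℕ.* suc D
      P≡ = m≡m%n+[m/n]*n P (suc D)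
      len* : length L* < P ℕ.* suc N
      len* = begin-strict
        length L*                             ≡⟨ ListP.length-++ (copies q L) ⟩
        length (copies q L) ℕ.+ length (copies r B) ≡⟨ cong₂ ℕ._+_ (length-copies q L) (length-copies r B) ⟩
        q ℕ.* length L ℕ.+ r ℕ.* length B     ≤⟨ ℕP.+-mono-≤ (ℕP.*-monoʳ-≤ q len)
            (ℕP.*-monoˡ-≤ (length B) (ℕP.<⇒≤ (m%n<n P (suc D)))) ⟩
        q ℕ.* (suc D ℕ.* N) ℕ.+ k             ≡⟨ cong (ℕ._+ k) (sym (ℕP.*-assoc q (suc D) N)) ⟩
        q ℕ.* suc D ℕ.* N ℕ.+ k               ≤⟨ ℕP.+-monoˡ-≤ k
            (ℕP.*-monoˡ-≤ N (ℕP.≤-trans (ℕP.m≤n+m _ r) (ℕP.≤-reflexive (sym P≡)))) ⟩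
        P ℕ.* N ℕ.+ k                         <⟨ ℕP.+-monoʳ-< (P ℕ.* N) (n<2^n k) ⟩
        P ℕ.* N ℕ.+ P                         ≡⟨ ℕP.+-comm (P ℕ.* N) P ⟩
        P ℕ.+ P ℕ.* N                         ≡⟨ sym (ℕP.*-suc P N) ⟩
        P ℕ.* suc N                           ∎
        where open ℕP.≤-Reasoning
      eL* : ∀ c → sumE L* c ≡ ℤ.+ P * v c
      eL* c = begin
        sumE L* c                               ≡⟨ sumE-++ (copies q L) (copies r B) c ⟩
        sumE (copies q L) c + sumE (copies r B) c ≡⟨ cong₂ _+_ (trans (sum-copies q L c) (cong (ℤ.+ q *_) (eL c)))
            (trans (sum-copies r B c) (cong (ℤ.+ r *_) (eB c))) ⟩
        ℤ.+ q * (ℤ.+ suc D * v c) + ℤ.+ r * v c   ≡⟨ ar (ℤ.+ q) (ℤ.+ suc D) (ℤ.+ r) (v c) ⟩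
        (ℤ.+ r + ℤ.+ q * ℤ.+ suc D) * v c         ≡⟨ cong (λ x → (ℤ.+ r + x) * v c) (sym (ℤP.pos-* q (suc D))) ⟩
        (ℤ.+ r + ℤ.+ (q ℕ.* suc D)) * v c         ≡⟨ cong (λ x → ℤ.+ x * v c) (sym P≡) ⟩
        ℤ.+ P * v c                               ∎
        where
        open ≡-Reasoning
        ar : ∀ q d r v → q * (d * v) + r * v ≡ (r + q * d) * v
        ar = solve-∀

  -- The lattice generated by the edge vectors

  toTrail : ∀ {i j} → Reach G i j → Trail i j
  toTrail here       = []
  toTrail (step p w) = step true p (toTrail w)

  -- Reversing the signs in `minus` makes every edge follow the pattern + - + -, so each boundary
  -- vector e_a ± e_b belongs to the lattice of edge vectors.
  alternating : ∀ {a b} (T : Trail a b) → ∃[ L ] (∀ k → sumE L k ≡ boundary (odd T) a b k)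
  alternating {a} {b} T = plus T ++ negE (minus T) , λ k → trans (sumE-++ (plus T) (negE (minus T)) k)
    (trans (cong₂ _+_ (plus-minus T k) (sum-negE (minus T) k)) (ar (sumE (minus T) k) (boundary (odd T) a b k)))
    where
    ar : ∀ m b → m + b + - m ≡ b
    ar = solve-∀

  -- A linear equation valid on the edge vectors is valid on all their signed sums. Such relations
  -- recover the coordinates that a chart omits.
  linear-relation : (g : Fin n → ℤ) (h : ℤ) → (∀ i j → adj G i j ≡ true → g i + g j ≡ h) →
    ∀ L → sum (λ i → g i * sumE L (inject₁ i)) ≡ h * sumE L (fromℕ n)
  linear-relation g h onEdges [] = trans (trans (sum-cong-≗ (λ i → ℤP.*-zeroʳ (g i))) (sum-replicate-zero n))
      (sym (ℤP.*-zeroʳ h))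
  linear-relation g h onEdges (e ∷ L) = begin
    sum (λ i → g i * (vec e (inject₁ i) + sumE L (inject₁ i)))
      ≡⟨ sum-cong-≗ (λ i → ℤP.*-distribˡ-+ (g i) (vec e (inject₁ i)) (sumE L (inject₁ i))) ⟩
    sum (λ i → g i * vec e (inject₁ i) + g i * sumE L (inject₁ i))
      ≡⟨ ∑-distrib-+ (λ i → g i * vec e (inject₁ i)) (λ i → g i * sumE L (inject₁ i)) ⟩
    sum (λ i → g i * vec e (inject₁ i)) + sum (λ i → g i * sumE L (inject₁ i))
      ≡⟨ cong₂ _+_ (onVec e) (linear-relation g h onEdges L) ⟩
    h * vec e (fromℕ n) + h * sumE L (fromℕ n)
      ≡⟨ sym (ℤP.*-distribˡ-+ h (vec e (fromℕ n)) (sumE L (fromℕ n))) ⟩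
    h * (vec e (fromℕ n) + sumE L (fromℕ n)) ∎
    where
    open ≡-Reasoning
    onEdge : ∀ i j → adj G i j ≡ true → sum (λ k → g k * edgeVec i j (inject₁ k)) ≡ h * edgeVec i j (fromℕ n)
    onEdge i j p = begin
      sum (λ k → g k * edgeVec i j (inject₁ k))
        ≡⟨ sum-cong-≗ (λ k → trans (cong (g k *_) (trans (edgeVec-inner i j k)
            (cong₂ _+_ (unit-comm i k) (unit-comm j k))))
             (ℤP.*-distribˡ-+ (g k) (unit k i) (unit k j))) ⟩
      sum (λ k → g k * unit k i + g k * unit k j)
        ≡⟨ ∑-distrib-+ (λ k → g k * unit k i) (λ k → g k * unit k j) ⟩
      sum (λ k → g k * unit k i) + sum (λ k → g k * unit k j)
        ≡⟨ cong₂ _+_ (sum-unit g i) (sum-unit g j) ⟩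
      g i + g j
        ≡⟨ onEdges i j p ⟩
      h ≡⟨ sym (ℤP.*-identityʳ h) ⟩
      h * 1ℤ
        ≡⟨ cong (h *_) (sym (edgeVec-top i j)) ⟩
      h * edgeVec i j (fromℕ n) ∎
    onVec : ∀ e → sum (λ k → g k * vec e (inject₁ k)) ≡ h * vec e (fromℕ n)
    onVec (sedge true  i j p) = onEdge i j p
    onVec (sedge false i j p) = begin
      sum (λ k → g k * - edgeVec i j (inject₁ k))
        ≡⟨ sum-cong-≗ (λ k → sym (ℤP.neg-distribʳ-* (g k) (edgeVec i j (inject₁ k)))) ⟩
      sum (λ k → - (g k * edgeVec i j (inject₁ k)))
        ≡⟨ sum-negate (λ k → g k * edgeVec i j (inject₁ k)) ⟩
      - sum (λ k → g k * edgeVec i j (inject₁ k))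
        ≡⟨ cong -_ (onEdge i j p) ⟩
      - (h * edgeVec i j (fromℕ n))
        ≡⟨ ℤP.neg-distribʳ-* h (edgeVec i j (fromℕ n)) ⟩
      h * - edgeVec i j (fromℕ n) ∎

  -- k of the n + 1 coordinates, on which the lattice generated by the edge vectors projects bijectively onto ℤᵏ.
  record Chart : Set where
    field
      k         : ℕ
      π         : Fin k → Fin (suc n)
      lift      : (z : Fin k → ℤ) → ∃[ L ] (∀ i → sumE L (π i) ≡ z i)
      injective : ∀ L M → (∀ i → sumE L (π i) ≡ sumE M (π i)) → ∀ c → sumE L c ≡ sumE M c

  -- Rational points as signed edge sums

  -- A point y of weight w: some positive multiple (1 + D)·y is a sum of (1 + D)·w signed edges.
  Rep : ℚ → Vecℚ (suc n) → Set
  Rep w y = Σ ℕ λ D → Σ (List SEdge) λ L →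
    ι (ℤ.+ suc D) ℚ.* w ≡ ι (ℤ.+ length L) × (∀ k → ι (ℤ.+ suc D) ℚ.* y k ≡ ι (sumE L k))

  rep-resp : ∀ {w w′ y y′} → w ≡ w′ → y ≐ y′ → Rep w y → Rep w′ y′
  rep-resp refl e (D , L , l , s) = D , L , l , λ k → trans (cong (ι (ℤ.+ suc D) ℚ.*_) (sym (e k))) (s k)

  rep-zero : Rep 0ℚ (λ _ → 0ℚ)
  rep-zero = 0 , [] , refl , λ k → refl

  rep-+ : ∀ {w w′ y y′} → Rep w y → Rep w′ y′ → Rep (w ℚ.+ w′) (λ k → y k ℚ.+ y′ k)
  rep-+ {w} {w′} {y} {y′} (D , L , l , s) (D′ , L′ , l′ , s′) =
    -- The predecessor of the common denominator (1 + D)·(1 + D′). Each list is repeated as often as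
    -- the other denominator says.
    D′ ℕ.+ D ℕ.* suc D′ , copies (suc D′) L ++ copies (suc D) L′ ,
    trans (common w w′ (ℤ.+ length L) (ℤ.+ length L′) l l′) (cong ι (sym len)) ,
    λ k → trans (common (y k) (y′ k) (sumE L k) (sumE L′ k) (s k) (s′ k))
      (cong ι (sym (trans (sumE-++ (copies (suc D′) L) _ k) (cong₂ _+_ (sum-copies (suc D′) L k)
          (sum-copies (suc D) L′ k)))))
    where
    len : ℤ.+ length (copies (suc D′) L ++ copies (suc D) L′) ≡ ℤ.+ suc D′ * ℤ.+ length L + ℤ.+ suc D * ℤ.+ length L′
    len = trans (cong ℤ.+_ (trans (ListP.length-++ (copies (suc D′) L))
        (cong₂ ℕ._+_ (length-copies (suc D′) L) (length-copies (suc D) L′))))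
      (trans (ℤP.pos-+ (suc D′ ℕ.* length L) (suc D ℕ.* length L′))
          (cong₂ _+_ (ℤP.pos-* (suc D′) (length L)) (ℤP.pos-* (suc D) (length L′))))
    common : ∀ a b x z → ι (ℤ.+ suc D) ℚ.* a ≡ ι x → ι (ℤ.+ suc D′) ℚ.* b ≡ ι z →
      ι (ℤ.+ (suc D ℕ.* suc D′)) ℚ.* (a ℚ.+ b) ≡ ι (ℤ.+ suc D′ * x + ℤ.+ suc D * z)
    common a b x z e f = begin
      ι (ℤ.+ (suc D ℕ.* suc D′)) ℚ.* (a ℚ.+ b)
        ≡⟨ cong (ℚ._* (a ℚ.+ b)) (trans (cong ι (ℤP.pos-* (suc D) (suc D′))) (ι-* (ℤ.+ suc D) (ℤ.+ suc D′))) ⟩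
      d ℚ.* d′ ℚ.* (a ℚ.+ b)
        ≡⟨ ar d d′ a b ⟩
      d′ ℚ.* (d ℚ.* a) ℚ.+ d ℚ.* (d′ ℚ.* b)
        ≡⟨ cong₂ (λ p q → d′ ℚ.* p ℚ.+ d ℚ.* q) e f ⟩
      d′ ℚ.* ι x ℚ.+ d ℚ.* ι z
        ≡⟨ cong₂ ℚ._+_ (sym (ι-* (ℤ.+ suc D′) x)) (sym (ι-* (ℤ.+ suc D) z)) ⟩
      ι (ℤ.+ suc D′ * x) ℚ.+ ι (ℤ.+ suc D * z)
        ≡⟨ sym (ι-+ (ℤ.+ suc D′ * x) (ℤ.+ suc D * z)) ⟩
      ι (ℤ.+ suc D′ * x + ℤ.+ suc D * z) ∎
      where
      open ≡-Reasoning
      d d′ : ℚ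
      d  = ι (ℤ.+ suc D)
      d′ = ι (ℤ.+ suc D′)
      ar : ∀ d d′ a b → d ℚ.* d′ ℚ.* (a ℚ.+ b) ≡ d′ ℚ.* (d ℚ.* a) ℚ.+ d ℚ.* (d′ ℚ.* b)
      ar = RingSolver.solve-∀ ringℚ

  -- A negative factor reverses the signs of the edges without changing their number, hence the
  -- absolute value in the weight.
  rep-scale : ∀ c {w y} → Rep w y → Rep (ℚ.∣ c ∣ ℚ.* w) (λ k → c ℚ.* y k)
  rep-scale c@(mkℚ p q _) {w} {y} (D , L , l , s) = D ℕ.+ q ℕ.* suc D , multiple p L ,
    trans (common ℚ.∣ c ∣ (ℤ.+ ℤ.∣ p ∣) w (ℤ.+ length L) (ι-denominator ℚ.∣ c ∣) l)
      (cong ι (trans (sym (ℤP.pos-* ℤ.∣ p ∣ (length L))) (cong ℤ.+_ (sym (length-multiple p L))))) ,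
    λ k → trans (common c p (y k) (sumE L k) (ι-denominator c) (s k)) (cong ι (sym (sum-multiple p L k)))
    where
    common : ∀ c p a x → ι (ℤ.+ suc q) ℚ.* c ≡ ι p → ι (ℤ.+ suc D) ℚ.* a ≡ ι x →
      ι (ℤ.+ (suc q ℕ.* suc D)) ℚ.* (c ℚ.* a) ≡ ι (p * x)
    common c p a x e f = begin
      ι (ℤ.+ (suc q ℕ.* suc D)) ℚ.* (c ℚ.* a)
        ≡⟨ cong (ℚ._* (c ℚ.* a)) (trans (cong ι (ℤP.pos-* (suc q) (suc D))) (ι-* (ℤ.+ suc q) (ℤ.+ suc D))) ⟩
      ι (ℤ.+ suc q) ℚ.* ι (ℤ.+ suc D) ℚ.* (c ℚ.* a)
        ≡⟨ ar (ι (ℤ.+ suc q)) (ι (ℤ.+ suc D)) c a ⟩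
      (ι (ℤ.+ suc q) ℚ.* c) ℚ.* (ι (ℤ.+ suc D) ℚ.* a)
        ≡⟨ cong₂ ℚ._*_ e f ⟩
      ι p ℚ.* ι x
        ≡⟨ sym (ι-* p x) ⟩
      ι (p * x) ∎
      where
      open ≡-Reasoning
      ar : ∀ q d c a → q ℚ.* d ℚ.* (c ℚ.* a) ≡ (q ℚ.* c) ℚ.* (d ℚ.* a)
      ar = RingSolver.solve-∀ ringℚ

  rep-lincomb : ∀ {r} (c : Fin r → ℚ) (w : Fin r → ℚ) (p : Fin r → Vecℚ (suc n)) → (∀ i → Rep (w i) (p i)) →
    Rep (sumℚ (λ i → ℚ.∣ c i ∣ ℚ.* w i)) (lincomb c p)
  rep-lincomb {zero}  c w p R = rep-zero
  rep-lincomb {suc r} c w p R = rep-+ (rep-scale (c zero) {w zero} {p zero} (R zero))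
      (rep-lincomb (λ i → c (suc i)) (λ i → w (suc i)) (λ i → p (suc i)) (λ i → R (suc i)))

  rep-convex : ∀ {r} (c : Fin r → ℚ) (p : Fin r → Vecℚ (suc n)) → (∀ i → Rep 1ℚ (p i)) → (∀ i → 0ℚ ℚ.≤ c i) →
      sumℚ c ≡ 1ℚ →
    Rep 1ℚ (lincomb c p)
  rep-convex c p R c≥0 Σc = rep-resp (trans (sumℚ-cong (λ i → trans (ℚP.*-identityʳ ℚ.∣ c i ∣)
      (ℚP.0≤p⇒∣p∣≡p (c≥0 i)))) Σc) (λ k → refl)
    (rep-lincomb c (λ _ → 1ℚ) p R)

  Edge : SetQ n
  Edge x = ∃[ i ] ∃[ j ] (adj G i j ≡ true × x ≐ eij i j)

  rep-edgePolytope : ∀ p → EdgePolytope G p → Rep 1ℚ (snoc p 1ℚ)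
  rep-edgePolytope p (r , q , c , onEdges , c≥0 , Σc , p≐) = rep-resp refl eq
    (rep-convex c (λ i → snoc (q i) 1ℚ) (λ i → edge (onEdges i)) c≥0 Σc)
    where
    edge : ∀ {x} → Edge x → Rep 1ℚ (snoc x 1ℚ)
    edge {x} (i , j , a , e) = 0 , sedge true i j a ∷ [] , refl , λ k → trans (ℚP.*-identityˡ _) (val k)
      where
      val : ∀ k → snoc x 1ℚ k ≡ ι (edgeVec i j k + 0ℤ)
      val k rewrite ℤP.+-identityʳ (edgeVec i j k) = sym (≐-snoc {y = λ k → ι (edgeVec i j k)}
        (λ v → trans (cong ι (edgeVec-inner i j v)) (sym (trans (e v) (eij≡ i j v)))) (cong ι (edgeVec-top i j)) k)
    eq : lincomb c (λ i → snoc (q i) 1ℚ) ≐ snoc p 1ℚ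
    eq = ≐-snoc (λ v → trans (sumℚ-cong (λ i → cong (c i ℚ.*_) (snoc-inject₁ (q i) 1ℚ v))) (sym (p≐ v)))
      (trans (sumℚ-cong (λ i → trans (cong (c i ℚ.*_) (snoc-last (q i) 1ℚ)) (ℚP.*-identityʳ (c i)))) Σc)

  Generator : SetQ (suc n)
  Generator x = ∃[ p ] (EdgePolytope G p × (x ≐ snoc p 1ℚ ⊎ x ≐ snoc (neg p) (ℚ.- 1ℚ)))

  rep-generator : ∀ {x} → Generator x → Rep 1ℚ x
  rep-generator (p , P , inj₁ e) = rep-resp refl (λ k → sym (e k)) (rep-edgePolytope p P)
  rep-generator (p , P , inj₂ e) = rep-resp refl eq (rep-scale (ℚ.- 1ℚ) {1ℚ} {snoc p 1ℚ} (rep-edgePolytope p P))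
    where
    minus-one : ∀ x → ℚ.- 1ℚ ℚ.* x ≡ ℚ.- x
    minus-one x = trans (sym (ℚP.neg-distribˡ-* 1ℚ x)) (cong ℚ.-_ (ℚP.*-identityˡ x))
    eq : (λ k → ℚ.- 1ℚ ℚ.* snoc p 1ℚ k) ≐ _
    eq k = trans (≐-snoc {y = λ k → ℚ.- 1ℚ ℚ.* snoc p 1ℚ k} {x = neg p} {t = ℚ.- 1ℚ}
      (λ v → trans (cong (ℚ.- 1ℚ ℚ.*_) (snoc-inject₁ p 1ℚ v)) (minus-one (p v)))
      (trans (cong (ℚ.- 1ℚ ℚ.*_) (snoc-last p 1ℚ)) (minus-one 1ℚ)) k) (sym (e k))

  Ω⇒rep : ∀ {x} → Ω (EdgePolytope G) x → Rep 1ℚ x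
  Ω⇒rep (r , q , c , gens , c≥0 , Σc , x≐) = rep-resp refl (λ k → sym (x≐ k))
      (rep-convex c q (λ i → rep-generator (gens i)) c≥0 Σc)

  -- Coefficients of an affine combination may be negative, so nothing is claimed about the weight.
  Aff⇒rep : ∀ {x} → Aff (Ω (EdgePolytope G)) x → ∃[ w ] Rep w x
  Aff⇒rep (r , q , c , inΩ , Σc , x≐) = _ , rep-resp refl (λ k → sym (x≐ k))
      (rep-lincomb c (λ _ → 1ℚ) q (λ i → Ω⇒rep (inΩ i)))

  vecℚ : SEdge → Vecℚ (suc n)
  vecℚ e k = ι (vec e k)

  generator-edge : ∀ e → Generator (vecℚ e)
  generator-edge (sedge s i j a) = eij i j , Conv-point Edge {eij i j} (i , j , a , λ k → refl) , side s
    where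
    side : ∀ s → vecℚ (sedge s i j a) ≐ snoc (eij i j) 1ℚ ⊎ vecℚ (sedge s i j a) ≐ snoc (neg (eij i j)) (ℚ.- 1ℚ)
    side true  = inj₁ (≐-snoc (λ v → trans (cong ι (edgeVec-inner i j v)) (sym (eij≡ i j v)))
        (cong ι (edgeVec-top i j)))
    side false = inj₂ (≐-snoc (λ v → trans (cong (λ x → ι (- x)) (edgeVec-inner i j v))
        (trans (ι-neg (unit i v + unit j v)) (cong ℚ.-_ (sym (eij≡ i j v))))) (cong (λ x → ι (- x)) (edgeVec-top i j)))

  lincomb-edges : ∀ c L k → sumℚ (λ i → c ℚ.* vecℚ (lookup L i) k) ≡ c ℚ.* ι (sumE L k)
  lincomb-edges c L k = trans (sumℚ-*ˡ c (λ i → vecℚ (lookup L i) k)) (cong (c ℚ.*_) (go L))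
    where
    go : ∀ L → sumℚ (λ i → vecℚ (lookup L i) k) ≡ ι (sumE L k)
    go []      = refl
    go (e ∷ L) = trans (cong (vecℚ e k ℚ.+_) (go L)) (sym (ι-+ (vec e k) (sumE L k)))

  -- Weight 1 means that the list has exactly 1 + D entries. Giving each the coefficient 1/(1 + D)
  -- makes a convex combination; with `Ω⇒rep`, Ω consists exactly of the points of weight 1.
  rep⇒Ω : ∀ {x} → Rep 1ℚ x → Ω (EdgePolytope G) x
  rep⇒Ω {x} (D , L , l , s) = length L , (λ i → vecℚ (lookup L i)) , (λ _ → recip D) ,
      (λ i → generator-edge (lookup L i)) , (λ _ → recip≥0 D) ,
    trans (sumℚ-const (length L) (recip D)) (trans (cong (ℚ._* recip D)
        (trans (sym l) (ℚP.*-identityʳ (ι (ℤ.+ suc D))))) (trans (ℚP.*-comm (ι (ℤ.+ suc D)) (recip D))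
        (recip-inverse D))) ,
    λ k → trans (sym (ℚP.*-identityˡ (x k))) (trans (cong (ℚ._* x k) (sym (recip-inverse D)))
      (trans (ℚP.*-assoc (recip D) (ι (ℤ.+ suc D)) (x k)) (trans (cong (recip D ℚ.*_) (s k))
          (sym (lincomb-edges (recip D) L k)))))

  Ω-edge : ∀ e → Ω (EdgePolytope G) (vecℚ e)
  Ω-edge e = Conv-point Generator (generator-edge e)

  maybeVec : Maybe SEdge → Fin (suc n) → ℤ
  maybeVec nothing  k = 0ℤ
  maybeVec (just e) k = vec e k

  sum-pad : ∀ L N → length L ≤ N → ∀ k → sum (λ i → maybeVec (pad L N i) k) ≡ sumE L k
  sum-pad []      N       _       k = sum-replicate-zero N
  sum-pad (e ∷ L) (suc N) (s≤s l) k = cong (vec e k +_) (sum-pad L N l k)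

  rep-list : ∀ L → Rep (ι (ℤ.+ length L)) (λ k → ι (sumE L k))
  rep-list L = 0 , L , ℚP.*-identityˡ _ , λ k → ℚP.*-identityˡ _

  -- The origin is the midpoint of ê and -ê for some edge; the given vertex provides that edge. The
  -- entry 1 encodes the denominator 2.
  rep-origin : Fin n → Rep 1ℚ (λ _ → 0ℚ)
  rep-origin i with noIsolated G i
  ... | j , a = 1 , sedge true i j a ∷ sedge false i j a ∷ [] , refl , λ k → cong ι (sym (ar (edgeVec i j k)))
    where
    ar : ∀ x → x + (- x + 0ℤ) ≡ 0ℤ
    ar = solve-∀

  Ω-maybe : Fin n → ∀ e → Ω (EdgePolytope G) (λ k → ι (maybeVec e k))
  Ω-maybe i nothing  = rep⇒Ω (rep-origin i)
  Ω-maybe i (just e) = Ω-edge e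

  -- The origin comes first so that its coefficient can bring the total to 1. Linear combinations of
  -- edge vectors thereby become affine ones.
  points : (L : List SEdge) → Fin (suc (length L)) → Vecℚ (suc n)
  points L zero    = λ _ → 0ℚ
  points L (suc i) = vecℚ (lookup L i)

  points-Ω : Fin n → ∀ (L : List SEdge) i → Ω (EdgePolytope G) (points L i)
  points-Ω v L zero    = rep⇒Ω (rep-origin v)
  points-Ω v L (suc i) = Ω-edge (lookup L i)

  points-lattice : ∀ (L : List SEdge) i → Lattice (points L i)
  points-lattice L zero    k = 0ℤ , refl
  points-lattice L (suc i) k = vec (lookup L i) k , refl

  lincomb-points : ∀ a c L k → a ℚ.* 0ℚ ℚ.+ sumℚ (λ i → c ℚ.* vecℚ (lookup L i) k) ≡ c ℚ.* ι (sumE L k)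
  lincomb-points a c L k = trans (cong₂ ℚ._+_ (ℚP.*-zeroʳ a) (lincomb-edges c L k)) (ℚP.+-identityˡ _)

  complete-to-one : ∀ x → 1ℚ ℚ.+ ℚ.- x ℚ.+ x ≡ 1ℚ
  complete-to-one = RingSolver.solve-∀ ringℚ

  rep⇒Aff : Fin n → ∀ {w y} → Rep w y → Aff (Ω (EdgePolytope G)) y
  rep⇒Aff v {w} {y} (D , L , l , s) = suc (length L) , points L , coef , points-Ω v L , complete-to-one
      (sumℚ {length L} (λ _ → recip D)) ,
    λ k → trans (sym (ℚP.*-identityˡ (y k))) (trans (cong (ℚ._* y k) (sym (recip-inverse D)))
      (trans (ℚP.*-assoc (recip D) (ι (ℤ.+ suc D)) (y k)) (trans (cong (recip D ℚ.*_) (s k))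
          (sym (lincomb-points (coef zero) (recip D) L k)))))
    where
    coef : Fin (suc (length L)) → ℚ
    coef zero    = 1ℚ ℚ.+ ℚ.- sumℚ {length L} (λ _ → recip D)
    coef (suc i) = recip D

  IntAff-list : Fin n → ∀ L → IntAff (Ω (EdgePolytope G)) (λ k → ι (sumE L k))
  IntAff-list v L = suc (length L) , points L , coef , (λ i → points-Ω v L i , points-lattice L i) ,
    trans (cong (ℚ._+ sumℚ {length L} (λ _ → 1ℚ)) total) (complete-to-one (sumℚ {length L} (λ _ → 1ℚ))) ,
    λ k → sym (trans (lincomb-points (ι (coef zero)) 1ℚ L k) (ℚP.*-identityˡ _))
    where
    coef : Fin (suc (length L)) → ℤ
    coef zero    = 1ℤ + - (ℤ.+ length L)
    coef (suc i) = 1ℤ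
    total : ι (coef zero) ≡ 1ℚ ℚ.+ ℚ.- sumℚ {length L} (λ _ → 1ℚ)
    total = trans (ι-+ 1ℤ (- (ℤ.+ length L))) (cong (1ℚ ℚ.+_) (trans (ι-neg (ℤ.+ length L))
      (cong ℚ.-_ (sym (trans (sumℚ-const (length L) 1ℚ) (ℚP.*-identityʳ (ι (ℤ.+ length L))))))))

  scaled-list : ∀ {D} {y : Vecℚ (suc n)} L → (∀ k → ι (ℤ.+ suc D) ℚ.* y k ≡ ι (sumE L k)) → ∀ E k →
    ι (sumE (copies E L) k) ≡ ι (ℤ.+ E) ℚ.* (ι (ℤ.+ suc D) ℚ.* y k)
  scaled-list L s E k = trans (cong ι (sum-copies E L k)) (trans (ι-* (ℤ.+ E) (sumE L k))
      (cong (ι (ℤ.+ E) ℚ.*_) (sym (s k))))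

  -- Normality of Ω by means of a chart.

  module _ (C : Chart) where
    open Chart C

    swap-scalars : ∀ D E y → ι (ℤ.+ E) ℚ.* (ι (ℤ.+ D) ℚ.* y) ≡ ι (ℤ.+ D) ℚ.* (ι (ℤ.+ E) ℚ.* y)
    swap-scalars D E y = ar (ι (ℤ.+ E)) (ι (ℤ.+ D)) y
      where
      ar : ∀ e d y → e ℚ.* (d ℚ.* y) ≡ d ℚ.* (e ℚ.* y)
      ar = RingSolver.solve-∀ ringℚ

    -- Injectivity of the chart is an integral statement. Multiplying both points by both
    -- denominators turns them into signed edge sums, to which it applies; the denominators are then
    -- cancelled.
    chart-injective : ∀ {w w′ y y′} → Rep w y → Rep w′ y′ → (∀ i → y (π i) ≡ y′ (π i)) → y ≐ y′
    chart-injective {y = y} {y′} (D , L , _ , s) (D′ , L′ , _ , s′) e k = ι-cancelˡ D (ι-cancelˡ D′ (begin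
      ι (ℤ.+ suc D′) ℚ.* (ι (ℤ.+ suc D) ℚ.* y k)   ≡⟨ sym (scaled-list {D} {y} L s (suc D′) k) ⟩
      ι (sumE (copies (suc D′) L) k)           ≡⟨ cong ι (injective (copies (suc D′) L) (copies (suc D) L′) agree k) ⟩
      ι (sumE (copies (suc D) L′) k)           ≡⟨ scaled-list {D′} {y′} L′ s′ (suc D) k ⟩
      ι (ℤ.+ suc D) ℚ.* (ι (ℤ.+ suc D′) ℚ.* y′ k)  ≡⟨ swap-scalars (suc D′) (suc D) (y′ k) ⟩
      ι (ℤ.+ suc D′) ℚ.* (ι (ℤ.+ suc D) ℚ.* y′ k)  ∎))
      where
      open ≡-Reasoning
      agree : ∀ i → sumE (copies (suc D′) L) (π i) ≡ sumE (copies (suc D) L′) (π i)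
      agree i = ι-injective (begin
        ι (sumE (copies (suc D′) L) (π i))            ≡⟨ scaled-list {D} {y} L s (suc D′) (π i) ⟩
        ι (ℤ.+ suc D′) ℚ.* (ι (ℤ.+ suc D) ℚ.* y (π i))    ≡⟨ cong (λ x → ι (ℤ.+ suc D′) ℚ.* (ι (ℤ.+ suc D) ℚ.* x))
            (e i) ⟩
        ι (ℤ.+ suc D′) ℚ.* (ι (ℤ.+ suc D) ℚ.* y′ (π i))   ≡⟨ swap-scalars (suc D) (suc D′) (y′ (π i)) ⟩
        ι (ℤ.+ suc D) ℚ.* (ι (ℤ.+ suc D′) ℚ.* y′ (π i))   ≡⟨ sym (scaled-list {D′} {y′} L′ s′ (suc D) (π i)) ⟩
        ι (sumE (copies (suc D) L′) (π i))            ∎)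

    -- The projection onto the coordinates `π`, written as a matrix with zero translation as the
    -- definition of normality demands.
    chartMap : Vecℚ (suc n) → Vecℚ k
    chartMap = affMap (λ i j → ι (unit (π i) j)) (λ _ → 0ℚ)

    chartMap-coordinate : ∀ y i → chartMap y i ≡ y (π i)
    chartMap-coordinate y i = trans (ℚP.+-identityʳ _) (sumℚ-unit (π i) y)

    chart⇒latticeBij : Fin n → LatticeBij (Ω (EdgePolytope G)) chartMap
    chart⇒latticeBij v = (λ y _ lat i → let z , e = lat (π i) in z , trans (chartMap-coordinate y i) e) , surj ,
      λ y y′ a _ a′ _ e → chart-injective (proj₂ (Aff⇒rep a)) (proj₂ (Aff⇒rep a′))
        (λ i → trans (sym (chartMap-coordinate y i)) (trans (e i) (chartMap-coordinate y′ i)))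
      where
      surj : ∀ z → Lattice z → ∃[ y ] (Aff (Ω (EdgePolytope G)) y × Lattice y × chartMap y ≐ z)
      surj z lat = let L , e = lift (λ i → proj₁ (lat i)) in (λ k → ι (sumE L k)) , rep⇒Aff v (rep-list L) , (λ k → sumE L k , refl) ,
        λ i → trans (chartMap-coordinate (λ k → ι (sumE L k)) i) (trans (cong ι (e i)) (sym (proj₂ (lat i))))

    chart⇒spanning : Fin n → ∀ z → Lattice z → IntAff (Image chartMap (Ω (EdgePolytope G))) z
    chart⇒spanning v z lat = let L , e = lift (λ i → proj₁ (lat i)) ; r , p , c , pts , Σc , comb = IntAff-list v L in r , (λ i → chartMap (p i)) , c ,
      (λ i → (p i , proj₁ (pts i) , λ k → refl) , λ j → let x , f = proj₂ (pts i) (π j) in x , trans (chartMap-coordinate (p i) j) f) , Σc ,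
      λ j → trans (proj₂ (lat j)) (trans (cong ι (sym (e j))) (trans (comb (π j))
        (sumℚ-cong (λ i → cong (ι (c i) ℚ.*_) (sym (chartMap-coordinate (p i) j))))))

    -- Lifting `x` gives a list `B` of uncontrolled length. The N-fold copy of `L` and the (1 +
    -- D)-fold copy of `B` agree in the chart and hence everywhere. So (1 + D) times the sum of `B`
    -- is a sum of (1 + D)·N signed edges, which is the input of `divide`.
    decompose-rep : Fin n → ¬ TwoDisjointOddCycles G → ∀ N (x : Vecℚ k) (lat : Lattice x) w → Rep 1ℚ w →
        (∀ i → x i ≡ ι (ℤ.+ N) ℚ.* w (π i)) →
      Σ (Fin N → Vecℚ k) λ xs → (∀ i → Image chartMap (Ω (EdgePolytope G)) (xs i) × Lattice (xs i)) × (x ≐ vsum xs)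
    decompose-rep v ¬two N x lat w (D , L , l , s) x≐ = result
        (divide ¬two D N (λ c → sumE B c) (copies N L) B len total (λ c → refl))
      where
      B : List SEdge
      B = proj₁ (lift (λ i → proj₁ (lat i)))
      eB : ∀ i → sumE B (π i) ≡ proj₁ (lat i)
      eB = proj₂ (lift (λ i → proj₁ (lat i)))
      length≡ : length L ≡ suc D
      length≡ = ℤP.+-injective (sym (ι-injective (trans (sym (ℚP.*-identityʳ (ι (ℤ.+ suc D)))) l)))
      len : length (copies N L) ≤ suc D ℕ.* N
      len = ℕP.≤-reflexive (trans (length-copies N L) (trans (cong (N ℕ.*_) length≡) (ℕP.*-comm N (suc D))))
      agree : ∀ i → sumE (copies N L) (π i) ≡ sumE (copies (suc D) B) (π i)
      agree i = ι-injective (begin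
        ι (sumE (copies N L) (π i))                      ≡⟨ scaled-list {D} {w} L s N (π i) ⟩
        ι (ℤ.+ N) ℚ.* (ι (ℤ.+ suc D) ℚ.* w (π i))            ≡⟨ swap-scalars (suc D) N (w (π i)) ⟩
        ι (ℤ.+ suc D) ℚ.* (ι (ℤ.+ N) ℚ.* w (π i))            ≡⟨ cong (ι (ℤ.+ suc D) ℚ.*_)
            (trans (sym (x≐ i)) (trans (proj₂ (lat i)) (cong ι (sym (eB i))))) ⟩
        ι (ℤ.+ suc D) ℚ.* ι (sumE B (π i))                 ≡⟨ sym (ι-* (ℤ.+ suc D) (sumE B (π i))) ⟩
        ι (ℤ.+ suc D * sumE B (π i))                       ≡⟨ cong ι (sym (sum-copies (suc D) B (π i))) ⟩
        ι (sumE (copies (suc D) B) (π i))                ∎)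
        where open ≡-Reasoning
      total : ∀ c → sumE (copies N L) c ≡ ℤ.+ suc D * sumE B c
      total c = trans (injective (copies N L) (copies (suc D) B) agree c) (sum-copies (suc D) B c)
      result : ∃[ L′ ] (length L′ ≤ N × (∀ c → sumE L′ c ≡ sumE B c)) →
        Σ (Fin N → Vecℚ k) λ xs → (∀ i → Image chartMap (Ω (EdgePolytope G)) (xs i) × Lattice (xs i)) × (x ≐ vsum xs)
      result (L′ , l′ , e′) = (λ i → chartMap (pt i)) ,
        (λ i → (pt i , Ω-maybe v (pad L′ N i) , λ k → refl) , λ j → maybeVec (pad L′ N i) (π j) , chartMap-coordinate
            (pt i) j) ,
        λ j → begin
          x j                                            ≡⟨ proj₂ (lat j) ⟩
          ι (proj₁ (lat j))                              ≡⟨ cong ι (trans (sym (eB j)) (sym (e′ (π j)))) ⟩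
          ι (sumE L′ (π j))                            ≡⟨ cong ι (sym (sum-pad L′ N l′ (π j))) ⟩
          ι (sum (λ i → maybeVec (pad L′ N i) (π j)))    ≡⟨ sym (sumℚ-ι (λ i → maybeVec (pad L′ N i) (π j))) ⟩
          sumℚ (λ i → pt i (π j))                        ≡⟨ sumℚ-cong (λ i → sym (chartMap-coordinate (pt i) j)) ⟩
          vsum (λ i → chartMap (pt i)) j                        ∎
        where
        open ≡-Reasoning
        pt : Fin N → Vecℚ (suc n)
        pt i k = ι (maybeVec (pad L′ N i) k)

    chart⇒normal : ¬ TwoDisjointOddCycles G → Fin n → Normal (Ω (EdgePolytope G))
    chart⇒normal ¬two v = k , (λ i j → ι (unit (π i) j)) , (λ _ → 0ℚ) , chart⇒latticeBij v , chart⇒spanning v ,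
        decompose
      where
      decompose : NormalFD (Image chartMap (Ω (EdgePolytope G)))
      decompose N _ x lat (a , (w , w∈Ω , a≐) , x≐) = decompose-rep v ¬two N x lat w (Ω⇒rep w∈Ω)
        (λ i → trans (x≐ i) (cong (ι (ℤ.+ N) ℚ.*_) (trans (a≐ i) (chartMap-coordinate w i))))

  sum-tabulate : ∀ {r} (f : Fin r → SEdge) k → sumE (tabulate f) k ≡ sum (λ i → vec (f i) k)
  sum-tabulate {zero}  f k = refl
  sum-tabulate {suc r} f k = cong (vec (f zero) k +_) (sum-tabulate (λ i → f (suc i)) k)

  -- Cycles and lattice points of Ω

  cycleSum : Cycle G → Fin (suc n) → ℤ
  cycleSum C k = sum (λ i → unit (inject₁ (vert C i)) k)

  cycleEdges : Cycle G → List SEdge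
  cycleEdges C = sedge true (vert C (fromℕ (l C))) (vert C zero) (close C) ∷
    tabulate (λ i → sedge true (vert C (inject₁ i)) (vert C (suc i)) (consec C i))

  length-cycleEdges : ∀ C → length (cycleEdges C) ≡ suc (l C)
  length-cycleEdges C = cong suc (ListP.length-tabulate _)

  -- Each cycle vertex is the tail of one edge and the head of another. The closing edge supplies
  -- the last vertex missing from the tails and the first one missing from the heads.
  sum-cycleEdges : ∀ C k → sumE (cycleEdges C) k ≡ cycleSum C k + cycleSum C k + ℤ.+ suc (l C) * unit (fromℕ n) k
  sum-cycleEdges C k = begin
    x (fromℕ (l C)) + x zero + t + sumE (tabulate (λ i → sedge true (vert C (inject₁ i)) (vert C (suc i))
        (consec C i))) k
      ≡⟨ cong (x (fromℕ (l C)) + x zero + t +_) (sum-tabulate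
          (λ i → sedge true (vert C (inject₁ i)) (vert C (suc i)) (consec C i)) k) ⟩
    x (fromℕ (l C)) + x zero + t + sum (λ i → x (inject₁ i) + x (suc i) + t)
      ≡⟨ cong (x (fromℕ (l C)) + x zero + t +_) (trans (∑-distrib-+ (λ i → x (inject₁ i) + x (suc i)) (λ _ → t))
           (cong₂ _+_ (∑-distrib-+ (λ i → x (inject₁ i)) (λ i → x (suc i))) (sum-const (l C) t))) ⟩
    x (fromℕ (l C)) + x zero + t + (sum (λ i → x (inject₁ i)) + sum (λ i → x (suc i)) + ℤ.+ l C * t)
      ≡⟨ ar (x (fromℕ (l C))) (x zero) t (sum (λ i → x (inject₁ i))) (sum (λ i → x (suc i))) (ℤ.+ l C) ⟩
    (sum (λ i → x (inject₁ i)) + x (fromℕ (l C))) + (x zero + sum (λ i → x (suc i))) + (1ℤ + ℤ.+ l C) * t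
      ≡⟨ cong (λ s → s + cycleSum C k + ℤ.+ suc (l C) * t) (sym (sum-init-last x)) ⟩
    cycleSum C k + cycleSum C k + ℤ.+ suc (l C) * t ∎
    where
    open ≡-Reasoning
    x : Fin (suc (l C)) → ℤ
    x i = unit (inject₁ (vert C i)) k
    t : ℤ
    t = unit (fromℕ n) k
    ar : ∀ a b t p q r → a + b + t + (p + q + r * t) ≡ (p + a) + (b + q) + (1ℤ + r) * t
    ar = solve-∀

  cycleSum-own : ∀ C j → cycleSum C (inject₁ (vert C j)) ≡ 1ℤ
  cycleSum-own C j = trans (sum-cong-≗ same) (sum-unit (λ _ → 1ℤ) j)
    where
    same : ∀ i → unit (inject₁ (vert C i)) (inject₁ (vert C j)) ≡ 1ℤ * unit i j
    same i = trans (unit-inject₁ (vert C i) (vert C j)) (trans (go i j) (sym (ℤP.*-identityˡ (unit i j))))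
      where
      go : ∀ i j → unit (vert C i) (vert C j) ≡ unit i j
      go i j with i ≟ j
      ... | yes refl = trans (unit-diag (vert C i)) (sym (unit-diag i))
      ... | no i≢j   = trans (unit-≢ (λ e → i≢j (inj C i j e))) (sym (unit-≢ i≢j))

  cycleSum-other : ∀ C v → (∀ i → vert C i ≢ v) → cycleSum C (inject₁ v) ≡ 0ℤ
  cycleSum-other C v avoids = trans (sum-cong-≗ (λ i → trans (unit-inject₁ (vert C i) v) (unit-≢ (avoids i))))
      (sum-replicate-zero (suc (l C)))

  onCycle : Cycle G → (Fin (suc n) → ℤ) → ℤ
  onCycle C z = sum (λ j → z (inject₁ (vert C j)))

  onCycle-+ : ∀ C y z → onCycle C (λ k → y k + z k) ≡ onCycle C y + onCycle C z
  onCycle-+ C y z = ∑-distrib-+ (λ j → y (inject₁ (vert C j))) (λ j → z (inject₁ (vert C j)))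

  isPositive : SEdge → ℤ
  isPositive (sedge true  _ _ _) = 1ℤ
  isPositive (sedge false _ _ _) = 0ℤ

  positives : List SEdge → ℤ
  positives []      = 0ℤ
  positives (e ∷ L) = isPositive e + positives L

  positives≤length : ∀ L → positives L ℤ.≤ ℤ.+ length L
  positives≤length []      = ℤP.≤-refl
  positives≤length (e ∷ L) = ℤP.+-mono-≤ (le e) (positives≤length L)
    where
    le : ∀ e → isPositive e ℤ.≤ 1ℤ
    le (sedge true  _ _ _) = ℤP.≤-refl
    le (sedge false _ _ _) = ℤ.+≤+ z≤n

  -- The last coordinate is the number of positive minus the number of negative edges, the length is
  -- their sum.
  sum-top : ∀ L → sumE L (fromℕ n) + ℤ.+ length L ≡ positives L + positives L
  sum-top []      = refl
  sum-top (e ∷ L) = trans (ar (vec e (fromℕ n)) (sumE L (fromℕ n)) (ℤ.+ length L))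
    (trans (cong₂ _+_ (top e) (sum-top L)) (ar′ (isPositive e) (positives L)))
    where
    ar : ∀ v s l → v + s + (1ℤ + l) ≡ (v + 1ℤ) + (s + l)
    ar = solve-∀
    ar′ : ∀ a b → (a + a) + (b + b) ≡ (a + b) + (a + b)
    ar′ = solve-∀
    top : ∀ e → vec e (fromℕ n) + 1ℤ ≡ isPositive e + isPositive e
    top (sedge true  i j _) = cong (_+ 1ℤ) (edgeVec-top i j)
    top (sedge false i j _) = cong (λ x → - x + 1ℤ) (edgeVec-top i j)

  edgeVec-inner≥0 : ∀ i j v → 0ℤ ℤ.≤ edgeVec i j (inject₁ v)
  edgeVec-inner≥0 i j v = ℤP.≤-trans (ℤP.+-mono-≤ (unit≥0 i v) (unit≥0 j v))
      (ℤP.≤-reflexive (sym (edgeVec-inner i j v)))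

  -- Negative edges only lower a vertex coordinate; a positive edge raises it by at most 1, since
  -- there are no loops.
  vertex≤positives : ∀ L v → sumE L (inject₁ v) ℤ.≤ positives L
  vertex≤positives []      v = ℤP.≤-refl
  vertex≤positives (e ∷ L) v = ℤP.+-mono-≤ (le e) (vertex≤positives L v)
    where
    le : ∀ e → vec e (inject₁ v) ℤ.≤ isPositive e
    le (sedge false i j _) = ℤP.neg-mono-≤ (edgeVec-inner≥0 i j v)
    le (sedge true  i j a) with i ≟ v | j ≟ v
    ... | yes refl | yes refl with () ← trans (sym a) (adj-irrefl G i)
    ... | yes refl | no j≢v = ℤP.≤-reflexive (trans (edgeVec-inner i j i) (cong₂ _+_ (unit-diag i) (unit-≢ j≢v)))
    ... | no i≢v | yes refl = ℤP.≤-reflexive (trans (edgeVec-inner i j j) (cong₂ _+_ (unit-≢ i≢v) (unit-diag j)))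
    ... | no i≢v | no j≢v = ℤP.≤-trans (ℤP.≤-reflexive (trans (edgeVec-inner i j v)
        (cong₂ _+_ (unit-≢ i≢v) (unit-≢ j≢v)))) (ℤ.+≤+ z≤n)

  -- A positive edge has two ends, and each end occurs at most once on the cycle because its
  -- vertices are distinct.
  cycle≤positives : ∀ C L → onCycle C (sumE L) ℤ.≤ positives L + positives L
  cycle≤positives C []      = ℤP.≤-reflexive (sum-replicate-zero (suc (l C)))
  cycle≤positives C (e ∷ L) = ℤP.≤-trans (ℤP.≤-reflexive (onCycle-+ C (vec e) (sumE L)))
    (ℤP.≤-trans (ℤP.+-mono-≤ (le e) (cycle≤positives C L)) (ℤP.≤-reflexive (ar (isPositive e) (positives L))))
    where
    ar : ∀ a b → (a + a) + (b + b) ≡ (a + b) + (a + b)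
    ar = solve-∀
    le : ∀ e → onCycle C (vec e) ℤ.≤ isPositive e + isPositive e
    le (sedge true i j _) = ℤP.≤-trans (ℤP.≤-reflexive (trans (sum-cong-≗ (λ v → edgeVec-inner i j (vert C v)))
        (∑-distrib-+ (λ v → unit i (vert C v)) (λ v → unit j (vert C v)))))
      (ℤP.+-mono-≤ (sum-unit-injective≤1 i (vert C) (inj C)) (sum-unit-injective≤1 j (vert C) (inj C)))
    le (sedge false i j _) = ℤP.≤-trans (sum-mono (λ v → ℤP.neg-mono-≤ (edgeVec-inner≥0 i j (vert C v))))
        (ℤP.≤-reflexive (sum-replicate-zero (suc (l C))))

  -- Here (1 + D)·z is a sum of 1 + D signed edges. If the last coordinate is positive, counting two
  -- cycle vertices per edge is enough. If it is not, at most half of the edges are positive; every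
  -- vertex coordinate of z is then at most 1/2, hence at most 0 by integrality. These bounds stand
  -- in for the list of lattice points of Ω.
  classify : ∀ C D L (z : Fin (suc n) → ℤ) → length L ≡ suc D → (∀ k → ℤ.+ suc D * z k ≡ sumE L k) →
    (1ℤ ℤ.≤ z (fromℕ n) × onCycle C z ℤ.≤ ℤ.+ 2) ⊎ (z (fromℕ n) ℤ.≤ 0ℤ × onCycle C z ℤ.≤ 0ℤ)
  classify C D L z len e with ≤-or-> (z (fromℕ n)) 0ℤ
  ... | inj₂ t>0 = inj₁ (ℤP.i<j⇒suc[i]≤j t>0 , ℤP.*-cancelˡ-≤-pos (onCycle C z) (ℤ.+ 2) (ℤ.+ suc D) (begin
    ℤ.+ suc D * onCycle C z       ≡⟨ *-distribˡ-sum (ℤ.+ suc D) (λ j → z (inject₁ (vert C j))) ⟩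
    sum (λ j → ℤ.+ suc D * z (inject₁ (vert C j))) ≡⟨ sum-cong-≗ (λ j → e (inject₁ (vert C j))) ⟩
    onCycle C (sumE L)          ≤⟨ cycle≤positives C L ⟩
    positives L + positives L     ≤⟨ ℤP.+-mono-≤ (positives≤length L) (positives≤length L) ⟩
    ℤ.+ length L + ℤ.+ length L   ≡⟨ cong (λ x → ℤ.+ x + ℤ.+ x) len ⟩
    ℤ.+ suc D + ℤ.+ suc D         ≡⟨ ar (ℤ.+ suc D) ⟩
    ℤ.+ suc D * ℤ.+ 2             ∎))
    where
    open ℤP.≤-Reasoning
    ar : ∀ x → x + x ≡ x * ℤ.+ 2
    ar = solve-∀
  ... | inj₁ t≤0 = inj₂ (t≤0 , ℤP.≤-trans (sum-mono (λ j → nonpositive (vert C j)))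
      (ℤP.≤-reflexive (sum-replicate-zero (suc (l C)))))
    where
    open ℤP.≤-Reasoning
    d : ℤ
    d = ℤ.+ suc D
    half : positives L + positives L ℤ.≤ d
    half = begin
      positives L + positives L              ≡⟨ sym (sum-top L) ⟩
      sumE L (fromℕ n) + ℤ.+ length L      ≡⟨ cong₂ _+_ (sym (e (fromℕ n))) (cong ℤ.+_ len) ⟩
      d * z (fromℕ n) + d                    ≤⟨ ℤP.+-monoˡ-≤ d (ℤP.*-monoˡ-≤-nonNeg d t≤0) ⟩
      d * 0ℤ + d                             ≡⟨ trans (cong (_+ d) (ℤP.*-zeroʳ d)) (ℤP.+-identityˡ d) ⟩
      d                                      ∎
    ar : ∀ d z → d * (z + z) ≡ d * z + d * z
    ar = solve-∀
    double≤1 : ∀ v → z (inject₁ v) + z (inject₁ v) ℤ.≤ 1ℤ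
    double≤1 v = ℤP.*-cancelˡ-≤-pos (z (inject₁ v) + z (inject₁ v)) 1ℤ d (begin
      d * (z (inject₁ v) + z (inject₁ v))          ≡⟨ ar d (z (inject₁ v)) ⟩
      d * z (inject₁ v) + d * z (inject₁ v)        ≡⟨ cong₂ _+_ (e (inject₁ v)) (e (inject₁ v)) ⟩
      sumE L (inject₁ v) + sumE L (inject₁ v)  ≤⟨ ℤP.+-mono-≤ (vertex≤positives L v) (vertex≤positives L v) ⟩
      positives L + positives L                    ≤⟨ half ⟩
      d                                            ≡⟨ sym (ℤP.*-identityʳ d) ⟩
      d * 1ℤ                                       ∎)
    halve≤ : ∀ x → x + x ℤ.≤ 1ℤ → x ℤ.≤ 0ℤ
    halve≤ x le with ≤-or-> x 0ℤ
    ... | inj₁ x≤0 = x≤0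
    ... | inj₂ x>0 with ℤP.≤-trans (ℤP.+-mono-≤ (ℤP.i<j⇒suc[i]≤j x>0) (ℤP.i<j⇒suc[i]≤j x>0)) le
    ...   | ℤ.+≤+ (s≤s ())
    nonpositive : ∀ v → z (inject₁ v) ℤ.≤ 0ℤ
    nonpositive v = halve≤ (z (inject₁ v)) (double≤1 v)

  -- For an edge vector, p is to be 1 if it is positive and q is to be 1 if it is negative. One unit
  -- of charge pays for two vertices: p for vertices of the first cycle covered with sign +, q for
  -- vertices of the second covered with sign -.
  Charge : Cycle G → Cycle G → (Fin (suc n) → ℤ) → Set
  Charge C₁ C₂ z = Σ ℤ λ p → Σ ℤ λ q → p + q ℤ.≤ 1ℤ × onCycle C₁ z ℤ.≤ p + p × onCycle C₂ (λ k → - z k) ℤ.≤ q + q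

  -- The classification is applied to z on the first cycle and to -z on the second. The last
  -- coordinates of z and -z cannot both be at least 1, so at most one unit is spent.
  charge : ∀ C₁ C₂ D L (z : Fin (suc n) → ℤ) → length L ≡ suc D → (∀ k → ℤ.+ suc D * z k ≡ sumE L k) → Charge C₁ C₂ z
  charge C₁ C₂ D L z len e with classify C₁ D L z len e
    | classify C₂ D (negE L) (λ k → - z k) (trans (length-negE L) len)
        (λ k → trans (sym (ℤP.neg-distribʳ-* (ℤ.+ suc D) (z k))) (trans (cong -_ (e k)) (sym (sum-negE L k))))
  ... | inj₁ (t , p) | inj₁ (t′ , _) with ℤP.≤-trans (ℤP.+-mono-≤ t t′) (ℤP.≤-reflexive (ℤP.+-inverseʳ (z (fromℕ n))))
  ...   | ℤ.+≤+ ()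
  charge C₁ C₂ D L z len e | inj₁ (_ , p) | inj₂ (_ , q) = 1ℤ , 0ℤ , ℤP.≤-refl , p , q
  charge C₁ C₂ D L z len e | inj₂ (_ , p) | inj₁ (_ , q) = 0ℤ , 1ℤ , ℤP.≤-refl , p , q
  charge C₁ C₂ D L z len e | inj₂ (_ , p) | inj₂ (_ , q) = 0ℤ , 0ℤ , ℤ.+≤+ z≤n , p , q

  -- Oddness wins by rounding: 2·Σp ≥ 2m₁ + 1 forces Σp ≥ m₁ + 1, and likewise Σq ≥ m₂ + 1. The m₁ +
  -- m₂ + 1 points can spend only one unit each, one less than required.
  charges-exceed : ∀ C₁ C₂ m₁ m₂ (z : Fin (suc (m₁ ℕ.+ m₂)) → Fin (suc n) → ℤ) → (∀ i → Charge C₁ C₂ (z i)) →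
    onCycle C₁ (λ k → sum (λ i → z i k)) ≡ ℤ.+ suc (2 ℕ.* m₁) →
    onCycle C₂ (λ k → - sum (λ i → z i k)) ≡ ℤ.+ suc (2 ℕ.* m₂) → ⊥
  charges-exceed C₁ C₂ m₁ m₂ z ch e₁ e₂ = absurd (begin
    ℤ.+ suc m₁ + ℤ.+ suc m₂   ≤⟨ ℤP.+-mono-≤ (half m₁ (sum p)
        (bound C₁ z p (λ i → proj₁ (proj₂ (proj₂ (proj₂ (ch i))))) (ℤP.≤-reflexive (sym e₁))))
                                              (half m₂ (sum q)
                                                  (bound C₂ (λ i k → - z i k) q
                                                  (λ i → proj₂ (proj₂ (proj₂ (proj₂ (ch i)))))
                                                (ℤP.≤-reflexive
                                                    (trans (sym e₂)
                                                    (sum-cong-≗ (λ j → sym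
                                                    (sum-negate (λ i → z i (inject₁ (vert C₂ j)))))))))) ⟩
    sum p + sum q             ≡⟨ sym (∑-distrib-+ p q) ⟩
    sum (λ i → p i + q i)     ≤⟨ sum-mono (λ i → proj₁ (proj₂ (proj₂ (ch i)))) ⟩
    sum {suc (m₁ ℕ.+ m₂)} (λ _ → 1ℤ) ≡⟨ trans (sum-const (suc (m₁ ℕ.+ m₂)) 1ℤ) (ℤP.*-identityʳ _) ⟩
    ℤ.+ suc (m₁ ℕ.+ m₂)       ∎)
    where
    open ℤP.≤-Reasoning
    p q : Fin (suc (m₁ ℕ.+ m₂)) → ℤ
    p i = proj₁ (ch i)
    q i = proj₁ (proj₂ (ch i))
    bound : ∀ C (y : Fin (suc (m₁ ℕ.+ m₂)) → Fin (suc n) → ℤ) (r : Fin (suc (m₁ ℕ.+ m₂)) → ℤ) →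
        (∀ i → onCycle C (y i) ℤ.≤ r i + r i) →
      ∀ {x} → x ℤ.≤ onCycle C (λ k → sum (λ i → y i k)) → x ℤ.≤ sum r + sum r
    bound C y r le {x} x≤ = begin
      x                                              ≤⟨ x≤ ⟩
      sum (λ j → sum (λ i → y i (inject₁ (vert C j)))) ≡⟨ ∑-comm (λ j i → y i (inject₁ (vert C j))) ⟩
      sum (λ i → onCycle C (y i))                    ≤⟨ sum-mono le ⟩
      sum (λ i → r i + r i)                          ≡⟨ ∑-distrib-+ r r ⟩
      sum r + sum r                                  ∎
    half : ∀ m x → ℤ.+ suc (2 ℕ.* m) ℤ.≤ x + x → ℤ.+ suc m ℤ.≤ x
    half m x le with ≤-or-> x (ℤ.+ m)
    ... | inj₂ m<x = ℤP.i<j⇒suc[i]≤j m<x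
    ... | inj₁ x≤m = ⊥-elim (ℕP.<-irrefl (cong (m ℕ.+_) (ℕP.+-identityʳ m))
        (ℤP.drop‿+≤+ (ℤP.≤-trans le (ℤP.+-mono-≤ x≤m x≤m))))
    absurd : ℤ.+ suc m₁ + ℤ.+ suc m₂ ℤ.≤ ℤ.+ suc (m₁ ℕ.+ m₂) → ⊥
    absurd (ℤ.+≤+ (s≤s le)) = ℕP.<-irrefl refl (subst (_≤ m₁ ℕ.+ m₂) (ℕP.+-suc m₁ m₂) le)

  -- Pulling decompositions back through an arbitrary affine copy; the obstruction.

  rep-vsum : ∀ {r} (y : Fin r → Vecℚ (suc n)) → (∀ i → Rep 1ℚ (y i)) → ∃[ w ] Rep w (vsum y)
  rep-vsum {zero}  y R = 0ℚ , rep-zero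
  rep-vsum {suc r} y R = let w , S = rep-vsum (λ i → y (suc i)) (λ i → R (suc i)) in 1ℚ ℚ.+ w , rep-+ {1ℚ} {w} {y zero} {vsum (λ i → y (suc i))} (R zero) S

  rep-integral : ∀ {y} (z : Fin (suc n) → ℤ) → (∀ k → y k ≡ ι (z k)) → Rep 1ℚ y →
    Σ ℕ λ D → Σ (List SEdge) λ L → length L ≡ suc D × (∀ k → ℤ.+ suc D * z k ≡ sumE L k)
  rep-integral {y} z e (D , L , l , s) = D , L ,
    ℤP.+-injective (sym (ι-injective (trans (sym (ℚP.*-identityʳ (ι (ℤ.+ suc D)))) l))) ,
    λ k → ι-injective (trans (ι-* (ℤ.+ suc D) (z k)) (trans (cong (ι (ℤ.+ suc D) ℚ.*_) (sym (e k))) (s k)))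

  module _ (v : Fin n) {k : ℕ} (A : Fin k → Fin (suc n) → ℚ) (b : Vecℚ k)
      (bij : LatticeBij (Ω (EdgePolytope G)) (affMap A b)) where

    -- The hypothesis gives injectivity on lattice points only. Clearing the denominator of the
    -- difference of two rational points yields a lattice point of the span with linear image 0. It
    -- has the same image as the origin, hence equals it.
    φ-injective : ∀ {w w′ y y′} → Rep w y → Rep w′ y′ → affMap A b y ≐ affMap A b y′ → y ≐ y′
    φ-injective {w} {w′} {y} {y′} R R′ e = equal (rep-+ {w} {ℚ.∣ ℚ.- 1ℚ ∣ ℚ.* w′} {y} {λ j → ℚ.- 1ℚ ℚ.* y′ j} R
        (rep-scale (ℚ.- 1ℚ) {w′} {y′} R′))
      where
      diff : Vecℚ (suc n)
      diff j = y j ℚ.+ ℚ.- 1ℚ ℚ.* y′ j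
      linear-diff : ∀ i → linear A b diff i ≡ 0ℚ
      linear-diff i = trans (linear-+ A b y (λ j → ℚ.- 1ℚ ℚ.* y′ j) i)
        (trans (cong₂ ℚ._+_ (+-cancelʳ (linear A b y i) (linear A b y′ i) (b i) (e i))
            (linear-scale A b (ℚ.- 1ℚ) y′ i)) (ar (linear A b y′ i)))
        where
        ar : ∀ x → x ℚ.+ ℚ.- 1ℚ ℚ.* x ≡ 0ℚ
        ar = RingSolver.solve-∀ ringℚ
      equal : ∀ {u} → Rep u diff → y ≐ y′
      equal (D , L , _ , s) j = trans (ar (y j) (y′ j)) (trans
          (cong (ℚ._+ y′ j) (ι-cancelˡ D (trans (s j) (trans (vanishes j) (sym (ℚP.*-zeroʳ (ι (ℤ.+ suc D))))))))
          (ℚP.+-identityˡ (y′ j)))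
        where
        ar : ∀ x y → x ≡ (x ℚ.+ ℚ.- 1ℚ ℚ.* y) ℚ.+ y
        ar = RingSolver.solve-∀ ringℚ
        u : Vecℚ (suc n)
        u j = ι (sumE L j)
        linear-u : ∀ i → linear A b u i ≡ linear A b (λ _ → 0ℚ) i
        linear-u i = trans (linear-cong A b (λ j → sym (s j)) i) (trans (linear-scale A b (ι (ℤ.+ suc D)) diff i)
          (trans (cong (ι (ℤ.+ suc D) ℚ.*_) (linear-diff i)) (trans (ℚP.*-zeroʳ (ι (ℤ.+ suc D)))
              (sym (linear-zero A b i)))))
        vanishes : u ≐ (λ _ → 0ℚ)
        vanishes = proj₂ (proj₂ bij) u (λ _ → 0ℚ) (rep⇒Aff v (rep-list L)) (λ j → sumE L j , refl)
          (rep⇒Aff v (rep-origin v)) (λ _ → 0ℤ , refl) (λ i → cong (ℚ._+ b i) (linear-u i))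

    -- By surjectivity the lattice point `x` is also the image of a lattice point of the span;
    -- injectivity on rational points identifies that point with `y`.
    integral : ∀ {y x} → Rep 1ℚ y → x ≐ affMap A b y → Lattice x → Lattice y
    integral {y} {x} R e lat = let y′ , aff , lat′ , e′ = proj₁ (proj₂ bij) x lat in
      λ j → let z , f = lat′ j in z , trans (φ-injective R (proj₂ (Aff⇒rep aff)) (λ i → trans (sym (e i)) (sym (e′ i))) j) f

    -- V = N·w, so N·φ(w) = φ(V) + (N − 1)·φ(0) is a lattice point.
    decompose-multiple : NormalFD (Image (affMap A b) (Ω (EdgePolytope G))) → ∀ M (V : Fin (suc n) → ℤ) w → Rep 1ℚ w →
      (∀ j → ι (ℤ.+ suc M) ℚ.* w j ≡ ι (V j)) →
      Σ (Fin (suc M) → Fin (suc n) → ℤ) λ z → (∀ i → Rep 1ℚ (λ j → ι (z i j))) × (∀ j → sum (λ i → z i j) ≡ V j)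
    decompose-multiple nfd M V w R Nw = z , (λ i → rep-resp refl (λ j → proj₂ (ylat i j)) (yrep i)) ,
      λ j → ι-injective (trans (sym (sumℚ-ι (λ i → z i j))) (trans (sumℚ-cong (λ i → sym (proj₂ (ylat i j))))
          (total j)))
      where
      φ : Vecℚ (suc n) → Vecℚ k
      φ = affMap A b
      N : ℚ
      N = ι (ℤ.+ suc M)
      Vℚ : Vecℚ (suc n)
      Vℚ j = ι (V j)
      repV : Rep (ℚ.∣ N ∣ ℚ.* 1ℚ) Vℚ
      repV = rep-resp refl Nw (rep-scale N {1ℚ} {w} R)
      linear-Nw : ∀ i → N ℚ.* linear A b w i ≡ linear A b Vℚ i
      linear-Nw i = trans (sym (linear-scale A b N w i)) (linear-cong A b Nw i)
      latV : Lattice (φ Vℚ)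
      latV = proj₁ bij Vℚ (rep⇒Aff v repV) (λ j → V j , refl)
      lat0 : Lattice (φ (λ _ → 0ℚ))
      lat0 = proj₁ bij (λ _ → 0ℚ) (rep⇒Aff v (rep-origin v)) (λ j → 0ℤ , refl)
      x : Vecℚ k
      x = scale N (φ w)
      x≡ : ∀ i → x i ≡ linear A b Vℚ i ℚ.+ N ℚ.* b i
      x≡ i = trans (ℚP.*-distribˡ-+ N (linear A b w i) (b i)) (cong (ℚ._+ N ℚ.* b i) (linear-Nw i))
      latx : Lattice x
      latx i = proj₁ (latV i) + ℤ.+ M * proj₁ (lat0 i) , (begin
        x i                                              ≡⟨ x≡ i ⟩
        linear A b Vℚ i ℚ.+ N ℚ.* b i                    ≡⟨ cong (λ t → linear A b Vℚ i ℚ.+ t ℚ.* b i)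
            (ι-+ 1ℤ (ℤ.+ M)) ⟩
        linear A b Vℚ i ℚ.+ (1ℚ ℚ.+ ι (ℤ.+ M)) ℚ.* b i   ≡⟨ ar (linear A b Vℚ i) (b i) (ι (ℤ.+ M)) ⟩
        φ Vℚ i ℚ.+ ι (ℤ.+ M) ℚ.* (0ℚ ℚ.+ b i)            ≡⟨ cong (λ t → φ Vℚ i ℚ.+ ι (ℤ.+ M) ℚ.* (t ℚ.+ b i))
            (sym (linear-zero A b i)) ⟩
        φ Vℚ i ℚ.+ ι (ℤ.+ M) ℚ.* φ (λ _ → 0ℚ) i          ≡⟨ cong₂ (λ s t → s ℚ.+ ι (ℤ.+ M) ℚ.* t) (proj₂ (latV i))
            (proj₂ (lat0 i)) ⟩
        ι (proj₁ (latV i)) ℚ.+ ι (ℤ.+ M) ℚ.* ι (proj₁ (lat0 i)) ≡⟨ cong (ι (proj₁ (latV i)) ℚ.+_)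
            (sym (ι-* (ℤ.+ M) (proj₁ (lat0 i)))) ⟩
        ι (proj₁ (latV i)) ℚ.+ ι (ℤ.+ M * proj₁ (lat0 i)) ≡⟨ sym (ι-+ (proj₁ (latV i)) (ℤ.+ M * proj₁ (lat0 i))) ⟩
        ι (proj₁ (latV i) + ℤ.+ M * proj₁ (lat0 i))      ∎)
        where
        open ≡-Reasoning
        ar : ∀ l b m → l ℚ.+ (1ℚ ℚ.+ m) ℚ.* b ≡ l ℚ.+ b ℚ.+ m ℚ.* (0ℚ ℚ.+ b)
        ar = RingSolver.solve-∀ ringℚ
      result : Σ (Fin (suc M) → Vecℚ k) λ xs → (∀ i → Image φ (Ω (EdgePolytope G)) (xs i) × Lattice (xs i)) ×
          (x ≐ vsum xs)
      result = nfd (suc M) (s≤s z≤n) x latx (φ w , (w , rep⇒Ω R , λ i → refl) , λ i → refl)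
      xs : Fin (suc M) → Vecℚ k
      xs = proj₁ result
      inImage : ∀ i → Image φ (Ω (EdgePolytope G)) (xs i) × Lattice (xs i)
      inImage = proj₁ (proj₂ result)
      y : Fin (suc M) → Vecℚ (suc n)
      y i = proj₁ (proj₁ (inImage i))
      yrep : ∀ i → Rep 1ℚ (y i)
      yrep i = Ω⇒rep (proj₁ (proj₂ (proj₁ (inImage i))))
      xs≐ : ∀ i → xs i ≐ φ (y i)
      xs≐ i = proj₂ (proj₂ (proj₁ (inImage i)))
      ylat : ∀ i → Lattice (y i)
      ylat i = integral (yrep i) (xs≐ i) (proj₂ (inImage i))
      z : Fin (suc M) → Fin (suc n) → ℤ
      z i j = proj₁ (ylat i j)
      -- Both expressions for `x` contain the translation `b` exactly N times, so comparing them
      -- leaves an equation between linear parts.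
      linear-total : ∀ i → linear A b (vsum y) i ≡ linear A b Vℚ i
      linear-total i = +-cancelʳ (linear A b (vsum y) i) (linear A b Vℚ i) (N ℚ.* b i) (begin
        linear A b (vsum y) i ℚ.+ N ℚ.* b i                           ≡⟨ cong₂ ℚ._+_ (linear-vsum A b y i)
            (sym (sumℚ-const (suc M) (b i))) ⟩
        sumℚ (λ s → linear A b (y s) i) ℚ.+ sumℚ {suc M} (λ _ → b i)  ≡⟨ sym
            (sumℚ-+ (λ s → linear A b (y s) i) (λ _ → b i)) ⟩
        sumℚ (λ s → φ (y s) i)                                        ≡⟨ sumℚ-cong (λ s → sym (xs≐ s i)) ⟩
        vsum xs i                                                     ≡⟨ sym (proj₂ (proj₂ result) i) ⟩
        x i                                                           ≡⟨ x≡ i ⟩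
        linear A b Vℚ i ℚ.+ N ℚ.* b i                                 ∎)
        where open ≡-Reasoning
      total : vsum y ≐ Vℚ
      total = φ-injective (proj₂ (rep-vsum y yrep)) repV (λ i → cong (ℚ._+ b i) (linear-total i))

  normal⇒no-two-odd : Normal (Ω (EdgePolytope G)) → ¬ TwoDisjointOddCycles G
  normal⇒no-two-odd (k , A , b , bij , _ , nfd) (C₁ , C₂ , (m₁ , odd₁) , (m₂ , odd₂) , disjoint) =
    charges-exceed C₁ C₂ m₁ m₂ z charges first second
    where
    M : ℕ
    M = m₁ ℕ.+ m₂
    top : Fin (suc n) → ℤ
    top j = unit (fromℕ n) j
    -- The last coordinate is forced: twice this vector is to be the difference of the edge sums of
    -- the two cycles, which have 2m₁ + 1 and 2m₂ + 1 edges.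
    V : Fin (suc n) → ℤ
    V j = cycleSum C₁ j + - cycleSum C₂ j + (ℤ.+ m₁ + - (ℤ.+ m₂)) * top j
    L : List SEdge
    L = cycleEdges C₁ ++ negE (cycleEdges C₂)
    sumL : ∀ j → sumE L j ≡ V j + V j
    sumL j = begin
      sumE L j
        ≡⟨ trans (sumE-++ (cycleEdges C₁) (negE (cycleEdges C₂)) j)
            (cong (sumE (cycleEdges C₁) j +_) (sum-negE (cycleEdges C₂) j)) ⟩
      sumE (cycleEdges C₁) j + - sumE (cycleEdges C₂) j
        ≡⟨ cong₂ (λ s t → s + - t) (sum-cycleEdges C₁ j) (sum-cycleEdges C₂ j) ⟩
      (cycleSum C₁ j + cycleSum C₁ j + ℤ.+ suc (l C₁) * top j) + -
          (cycleSum C₂ j + cycleSum C₂ j + ℤ.+ suc (l C₂) * top j)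
        ≡⟨ cong₂ (λ s t → (cycleSum C₁ j + cycleSum C₁ j + s * top j) + - (cycleSum C₂ j + cycleSum C₂ j + t * top j))
            (odd-form m₁ odd₁) (odd-form m₂ odd₂) ⟩
      (cycleSum C₁ j + cycleSum C₁ j + (1ℤ + (ℤ.+ m₁ + ℤ.+ m₁)) * top j) + -
          (cycleSum C₂ j + cycleSum C₂ j + (1ℤ + (ℤ.+ m₂ + ℤ.+ m₂)) * top j)
        ≡⟨ ar (cycleSum C₁ j) (cycleSum C₂ j) (ℤ.+ m₁) (ℤ.+ m₂) (top j) ⟩
      V j + V j ∎
      where
      open ≡-Reasoning
      odd-form : ∀ {x} m → x ≡ suc (2 ℕ.* m) → ℤ.+ x ≡ 1ℤ + (ℤ.+ m + ℤ.+ m)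
      odd-form m refl = cong (λ t → ℤ.+ suc (m ℕ.+ t)) (ℕP.+-identityʳ m)
      ar : ∀ a b m k t → (a + a + (1ℤ + (m + m)) * t) + - (b + b + (1ℤ + (k + k)) * t) ≡
        (a + - b + (m + - k) * t) + (a + - b + (m + - k) * t)
      ar = solve-∀
    lenL : length L ≡ suc M ℕ.+ suc M
    lenL = trans (ListP.length-++ (cycleEdges C₁)) (trans (cong₂ ℕ._+_ (trans (length-cycleEdges C₁) odd₁)
      (trans (length-negE (cycleEdges C₂)) (trans (length-cycleEdges C₂) odd₂))) (ar m₁ m₂))
      where
      ar : ∀ a b → suc (2 ℕ.* a) ℕ.+ suc (2 ℕ.* b) ≡ suc (a ℕ.+ b) ℕ.+ suc (a ℕ.+ b)
      ar = ℕSolver.solve-∀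
    w : Vecℚ (suc n)
    w j = recip M ℚ.* ι (V j)
    N : ℚ
    N = ι (ℤ.+ suc M)
    Nw : ∀ j → N ℚ.* w j ≡ ι (V j)
    Nw j = trans (ar N (recip M) (ι (V j))) (trans (cong (ℚ._* ι (V j)) (recip-inverse M)) (ℚP.*-identityˡ (ι (V j))))
      where
      ar : ∀ n r v → n ℚ.* (r ℚ.* v) ≡ (r ℚ.* n) ℚ.* v
      ar = RingSolver.solve-∀ ringℚ
    repW : Rep 1ℚ w
    -- The denominator is 2N with N = 1 + M, equal to the number of edges of both cycles together;
    -- the first entry is its predecessor.
    repW = M ℕ.+ suc M , L , trans (ℚP.*-identityʳ (ι (ℤ.+ (suc M ℕ.+ suc M)))) (cong (λ t → ι (ℤ.+ t)) (sym lenL)) ,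
        λ j → begin
      ι (ℤ.+ (suc M ℕ.+ suc M)) ℚ.* w j   ≡⟨ cong (ℚ._* w j) (ι-+ (ℤ.+ suc M) (ℤ.+ suc M)) ⟩
      (N ℚ.+ N) ℚ.* w j                   ≡⟨ ℚP.*-distribʳ-+ (w j) N N ⟩
      N ℚ.* w j ℚ.+ N ℚ.* w j             ≡⟨ cong₂ ℚ._+_ (Nw j) (Nw j) ⟩
      ι (V j) ℚ.+ ι (V j)                 ≡⟨ sym (ι-+ (V j) (V j)) ⟩
      ι (V j + V j)                       ≡⟨ cong ι (sym (sumL j)) ⟩
      ι (sumE L j)                      ∎
      where open ≡-Reasoning
    decomposition : Σ (Fin (suc M) → Fin (suc n) → ℤ) λ z → (∀ i → Rep 1ℚ (λ j → ι (z i j))) ×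
        (∀ j → sum (λ i → z i j) ≡ V j)
    decomposition = decompose-multiple (vert C₁ zero) A b bij nfd M V w repW Nw
    z : Fin (suc M) → Fin (suc n) → ℤ
    z = proj₁ decomposition
    charges : ∀ i → Charge C₁ C₂ (z i)
    charges i = let D , L , len , e = rep-integral (z i) (λ k → refl) (proj₁ (proj₂ decomposition) i) in charge C₁ C₂ D L (z i) len e
    V-first : ∀ j → V (inject₁ (vert C₁ j)) ≡ 1ℤ
    V-first j = trans (cong₂ _+_ (cong₂ (λ s t → s + - t) (cycleSum-own C₁ j)
        (cycleSum-other C₂ (vert C₁ j) (λ i e → disjoint j i (sym e))))
      (cong ((ℤ.+ m₁ + - (ℤ.+ m₂)) *_) (unit-last-inject₁ (vert C₁ j))))
          (cong (1ℤ +_) (ℤP.*-zeroʳ (ℤ.+ m₁ + - (ℤ.+ m₂))))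
    V-second : ∀ j → V (inject₁ (vert C₂ j)) ≡ - 1ℤ
    V-second j = trans (cong₂ _+_ (cong₂ (λ s t → s + - t) (cycleSum-other C₁ (vert C₂ j) (λ i e → disjoint i j e))
        (cycleSum-own C₂ j))
      (cong ((ℤ.+ m₁ + - (ℤ.+ m₂)) *_) (unit-last-inject₁ (vert C₂ j))))
          (cong (- 1ℤ +_) (ℤP.*-zeroʳ (ℤ.+ m₁ + - (ℤ.+ m₂))))
    ones : ∀ {x m} → x ≡ suc (2 ℕ.* m) → sum {x} (λ _ → 1ℤ) ≡ ℤ.+ suc (2 ℕ.* m)
    ones {x} e = trans (sum-const x 1ℤ) (trans (ℤP.*-identityʳ (ℤ.+ x)) (cong ℤ.+_ e))
    first : onCycle C₁ (λ j → sum (λ i → z i j)) ≡ ℤ.+ suc (2 ℕ.* m₁)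
    first = trans (sum-cong-≗ (λ j → trans (proj₂ (proj₂ decomposition) (inject₁ (vert C₁ j))) (V-first j)))
        (ones {m = m₁} odd₁)
    second : onCycle C₂ (λ j → - sum (λ i → z i j)) ≡ ℤ.+ suc (2 ℕ.* m₂)
    second = trans (sum-cong-≗ (λ j → cong -_ (trans (proj₂ (proj₂ decomposition) (inject₁ (vert C₂ j)))
        (V-second j)))) (ones {m = m₂} odd₂)

-- Charts of a connected graph.

module _ {m : ℕ} (G : SimpleGraph (suc m)) (connected : Connected G) where

  -- The root is given the empty trail by hand, because the walk supplied by connectedness might be
  -- an odd closed one. So `isOdd zero` computes to `false`, which fixes the coefficient of the root
  -- in the relations below.
  toRoot : ∀ i → Trail G i zero
  toRoot zero    = []
  toRoot (suc i) = toTrail G (connected (suc i) zero)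

  isOdd : Fin (suc m) → Bool
  isOdd i = odd G (toRoot i)

  -- Away from the root and the last coordinate, the alternating walk from a vertex to the root is
  -- the unit vector of that vertex. Such walks therefore realise any prescribed values at the other
  -- vertices.
  combination : ∀ (z : Fin m → ℤ) → ∃[ L ] (∀ k → sumE G L k ≡ sum
      (λ i → z i * boundary G (isOdd (suc i)) (suc i) zero k))
  combination z = concatFin G (λ i → multiple G (z i) (W i)) , λ k →
    trans (sum-concatFin G (λ i → multiple G (z i) (W i)) k)
      (sum-cong-≗ (λ i → trans (sum-multiple G (z i) (W i) k)
          (cong (z i *_) (proj₂ (alternating G (toRoot (suc i))) k))))
    where
    W : Fin m → List (SEdge G)
    W i = proj₁ (alternating G (toRoot (suc i)))

  boundary-inner : ∀ o i j → boundary G o (suc i) zero (suc (inject₁ j)) ≡ unit i j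
  boundary-inner o i j rewrite unit-inject₁ i j | unit-last-inject₁ j = ar (unit i j) (endSign G o) (parity G o)
    where
    ar : ∀ u e p → u + e * 0ℤ + p * 0ℤ ≡ u
    ar = solve-∀

  combination-inner : ∀ z j → sumE G (proj₁ (combination z)) (suc (inject₁ j)) ≡ z j
  combination-inner z j = trans (proj₂ (combination z) (suc (inject₁ j)))
    (trans (sum-cong-≗ (λ i → cong (z i *_) (boundary-inner (isOdd (suc i)) i j))) (sum-unit z j))

  -- Here `isOdd` is a proper 2-colouring and each edge has one end of either colour. Hence the two
  -- classes have equal coordinate sums, and the sum over the odd class is the last coordinate.
  -- These two relations determine the root and the last coordinate, and m free coordinates remain.
  bipartite-chart : (∀ i j → adj G i j ≡ true → isOdd i ≢ isOdd j) → Chart G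
  bipartite-chart alternates = record
    { k = m ; π = λ i → suc (inject₁ i)
    ; lift = λ z → proj₁ (combination z) , combination-inner z
    ; injective = inj′ }
    where
    signs : ∀ i j → adj G i j ≡ true → endSign G (isOdd i) + endSign G (isOdd j) ≡ 0ℤ
    signs i j p with isOdd i | isOdd j | alternates i j p
    ... | true  | true  | o≢o = ⊥-elim (o≢o refl)
    ... | true  | false | _   = refl
    ... | false | true  | _   = refl
    ... | false | false | o≢o = ⊥-elim (o≢o refl)
    parities : ∀ i j → adj G i j ≡ true → parity G (isOdd i) + parity G (isOdd j) ≡ 1ℤ
    parities i j p with isOdd i | isOdd j | alternates i j p
    ... | true  | true  | o≢o = ⊥-elim (o≢o refl)
    ... | true  | false | _   = refl
    ... | false | true  | _   = refl
    ... | false | false | o≢o = ⊥-elim (o≢o refl)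
    root : ∀ L → sumE G L zero ≡ sum (λ i → endSign G (isOdd (suc i)) * sumE G L (suc (inject₁ i)))
    root L = solveFor (sumE G L zero) (sum (λ i → endSign G (isOdd (suc i)) * sumE G L (suc (inject₁ i))))
        (sumE G L (fromℕ (suc m)))
      (linear-relation G (λ i → endSign G (isOdd i)) 0ℤ signs L)
      where
      solveFor : ∀ x s t → - 1ℤ * x + s ≡ 0ℤ * t → x ≡ s
      solveFor x s t e = trans (a x s) (trans (cong (λ y → s + - y) e) (b s t))
        where
        a : ∀ x s → x ≡ s + - (- 1ℤ * x + s)
        a = solve-∀
        b : ∀ s t → s + - (0ℤ * t) ≡ s
        b = solve-∀
    last : ∀ L → sumE G L (fromℕ (suc m)) ≡ sum (λ i → parity G (isOdd (suc i)) * sumE G L (suc (inject₁ i)))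
    last L = solveFor (sumE G L zero) (sum (λ i → parity G (isOdd (suc i)) * sumE G L (suc (inject₁ i))))
        (sumE G L (fromℕ (suc m)))
      (linear-relation G (λ i → parity G (isOdd i)) 1ℤ parities L)
      where
      solveFor : ∀ x s t → 0ℤ * x + s ≡ 1ℤ * t → t ≡ s
      solveFor x s t e = trans (sym (ℤP.*-identityˡ t)) (trans (sym e) (a x s))
        where
        a : ∀ x s → 0ℤ * x + s ≡ s
        a = solve-∀
    inj′ : ∀ L M → (∀ i → sumE G L (suc (inject₁ i)) ≡ sumE G M (suc (inject₁ i))) → ∀ c → sumE G L c ≡ sumE G M c
    inj′ L M e zero = trans (root L) (trans (sum-cong-≗ (λ i → cong (endSign G (isOdd (suc i)) *_) (e i)))
        (sym (root M)))
    inj′ L M e (suc c) with view c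
    ... | ‵fromℕ     = trans (last L) (trans (sum-cong-≗ (λ i → cong (parity G (isOdd (suc i)) *_) (e i)))
        (sym (last M)))
    ... | ‵inject₁ i = e i

  -- An edge between vertices of equal parity, followed by their walks to the root, closes an odd
  -- walk. It puts 2e₀ with last coordinate 1 into the lattice, so the last coordinate can be
  -- adjusted without touching any vertex but the root, and only the root has to be omitted.
  odd-edge-chart : ∀ i j → adj G i j ≡ true → isOdd i ≡ isOdd j → Chart G
  odd-edge-chart i j p same = record { k = suc m ; π = suc ; lift = lift ; injective = inj′ }
    where
    W : Fin (suc m) → List (SEdge G)
    W i = proj₁ (alternating G (toRoot i))
    top : Fin (suc (suc m))
    top = fromℕ (suc m)
    -- Subtracting both walks from the edge gives 2e₀ with last coordinate 1 if the walks are even,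
    -- and the negative of that vector if they are odd; the factor corrects the sign.
    endSgn : Bool → ℤ
    endSgn true  = - 1ℤ
    endSgn false = 1ℤ
    C : List (SEdge G)
    C = multiple G (endSgn (isOdd i)) (sedge true i j p ∷ negE G (W i ++ W j))
    sumC : ∀ k → sumE G C k ≡ boundary G true zero zero k
    sumC k = trans (sum-multiple G (endSgn (isOdd i)) (sedge true i j p ∷ negE G (W i ++ W j)) k)
      (trans (cong (λ x → endSgn (isOdd i) * (edgeVec G i j k + x))
          (trans (sum-negE G (W i ++ W j) k) (cong -_ (trans (sumE-++ G (W i) (W j) k)
        (cong₂ _+_ (proj₂ (alternating G (toRoot i)) k) (trans (proj₂ (alternating G (toRoot j)) k)
            (cong (λ o → boundary G o j zero k) (sym same))))))))
        (closes (isOdd i)))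
      where
      closes : ∀ o → endSgn o *
          (edgeVec G i j k + - (boundary G o i zero k + boundary G o j zero k)) ≡ boundary G true zero zero k
      closes true = ar (unit (inject₁ i) k) (unit (inject₁ j) k) (unit zero k) (unit top k)
        where
        ar : ∀ x y z l → - 1ℤ * (x + y + l + - (x + 1ℤ * z + 1ℤ * l + (y + 1ℤ * z + 1ℤ * l))) ≡ z + 1ℤ * z + 1ℤ * l
        ar = solve-∀
      closes false = ar (unit (inject₁ i) k) (unit (inject₁ j) k) (unit zero k) (unit top k)
        where
        ar : ∀ x y z l → 1ℤ * (x + y + l + - (x + - 1ℤ * z + 0ℤ * l + (y + - 1ℤ * z + 0ℤ * l))) ≡ z + 1ℤ * z + 1ℤ * l
        ar = solve-∀
    lift : (z : Fin (suc m) → ℤ) → ∃[ L ] (∀ i → sumE G L (suc i) ≡ z i)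
    lift z = A ++ multiple G τ C , value
      where
      A : List (SEdge G)
      A = proj₁ (combination (λ i → z (inject₁ i)))
      -- What the last coordinate still lacks. `C` is 1 there and 0 at every vertex other than the
      -- root, so adding `τ` copies repairs it.
      τ : ℤ
      τ = z (fromℕ m) + - sumE G A top
      split : ∀ c → sumE G (A ++ multiple G τ C) c ≡ sumE G A c + τ * boundary G true zero zero c
      split c = trans (sumE-++ G A (multiple G τ C) c) (cong (sumE G A c +_)
          (trans (sum-multiple G τ C c) (cong (τ *_) (sumC c))))
      value : ∀ c → sumE G (A ++ multiple G τ C) (suc c) ≡ z c
      value c with view c
      ... | ‵fromℕ = trans (split top) (trans (cong (λ x → sumE G A top + τ * (0ℤ + x))
          (cong (1ℤ *_) (unit-diag (fromℕ m)))) (ar (sumE G A top) (z (fromℕ m))))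
        where
        ar : ∀ a z → a + (z + - a) * 1ℤ ≡ z
        ar = solve-∀
      ... | ‵inject₁ v = trans (split (suc (inject₁ v))) (trans
          (cong₂ (λ x y → x + τ * (0ℤ + 1ℤ * y)) (combination-inner (λ i → z (inject₁ i)) v) (unit-last-inject₁ v))
          (ar τ (z (inject₁ v))))
        where
        ar : ∀ t z → z + t * 0ℤ ≡ z
        ar = solve-∀
    -- Every edge vector has vertex coordinates with sum 2 and last coordinate 1; this relation
    -- returns the omitted root coordinate.
    root : ∀ L → sumE G L zero ≡ ℤ.+ 2 * sumE G L top + - sum (λ i → 1ℤ * sumE G L (suc (inject₁ i)))
    root L = solveFor (sumE G L zero) (sum (λ i → 1ℤ * sumE G L (suc (inject₁ i)))) (sumE G L top)
      (linear-relation G (λ _ → 1ℤ) (ℤ.+ 2) (λ _ _ _ → refl) L)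
      where
      solveFor : ∀ x s t → 1ℤ * x + s ≡ ℤ.+ 2 * t → x ≡ ℤ.+ 2 * t + - s
      solveFor x s t e = trans (a x s) (cong (_+ - s) e)
        where
        a : ∀ x s → x ≡ 1ℤ * x + s + - s
        a = solve-∀
    inj′ : ∀ L M → (∀ i → sumE G L (suc i) ≡ sumE G M (suc i)) → ∀ c → sumE G L c ≡ sumE G M c
    inj′ L M e zero = trans (root L) (trans (cong₂ (λ x y → ℤ.+ 2 * x + - y) (e (fromℕ m))
        (sum-cong-≗ (λ i → cong (1ℤ *_) (e (inject₁ i))))) (sym (root M)))
    inj′ L M e (suc c) = e c

  -- A finite search decides the case: either some edge joins two vertices whose walks to the root
  -- have equal parity, or walk parity is a proper 2-colouring.
  chart : Chart G
  chart with FinP.any? (λ i → FinP.any? (λ j → (adj G i j ≟ᵇ true) ×-dec (isOdd i ≟ᵇ isOdd j)))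
  ... | yes (i , j , p , same) = odd-edge-chart i j p same
  ... | no none = bipartite-chart (λ i j p same → none (i , j , p , same))
no-two-odd⇒normal : ∀ {n} → 1 ≤ n → (G : SimpleGraph n) → Connected G → ¬ TwoDisjointOddCycles G → Normal
    (Ω (EdgePolytope G))
no-two-odd⇒normal {suc m} _ G connected ¬two = chart⇒normal G (chart G connected) ¬two zero

theorem3p2 : (n : ℕ) → 1 ≤ n → (G : SimpleGraph n) → Connected G →
    (Normal (Ω (EdgePolytope G)) ⇔ (¬ TwoDisjointOddCycles G))
theorem3p2 n 1≤n G connected = mk⇔ (normal⇒no-two-odd G) (no-two-odd⇒normal 1≤n G connected)
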